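{- The proof calculus of the three-player differential game logic (given in the context) is sound: every formula that can be proven in the calculus is valid, i.e. true in all states.
   Context: States and coalitions. $\mathcal V$ is the set of variables; a state is a map $\omega:\mathcal V\to\mathbb R$; $\mathcal S$ is the set of all states; $\omega_x^r$ is the state that agrees with $\omega$ except that $x$ has value $r$; $\omega[\![e]\!]$ is the value of a term $e$ in $\omega$. There are three players $1,2,3$. A coalition is a nonempty subset of $\{1,2,3\}$; $\mathcal C$ is the set of all coalitions; $C_i=\{c\in\mathcal C: i\in c\}$, and $C_i^{\complement}$ is its complement in $\mathcal C$. $(\cdot)^\complement$ denotes set complement. Syntax. Hybrid games $\alpha,\beta$, state formulas $P_1,P_2,P_3,Q$ and game formulas $\pi_1,\pi_2$ are defined by the following grammar ($i\in\{1,2,3\}$, $C$ a set of coalitions, $x$ a variable, $e,\tilde e$ terms): - $\alpha,\beta ::= x:=e \mid \{x'=f(x)\,\&\,Q\}_i \mid\ ?_iQ \mid \alpha\cup_i\beta \mid \alpha;\beta \mid \alpha^{*i}$ - $P_1,P_2 ::= e\ge\tilde e \mid \neg P_1 \mid P_1\wedge P_2 \mid \forall x\,P_1 \mid \exists x\,P_1 \mid \Diamond C:\pi_1 \mid \Box C:\pi_1$ - $\pi_1,\pi_2 ::= P_1^{\mathcal C} \mid \pi_1\wedge\pi_2 \mid \neg\pi_1 \mid \langle\![\alpha]\!\rangle(\pi_1) \mid \Xi(P_1,P_2,P_3)$ Game formulas cannot stand on their own; they occur only as parts of state formulas. Other propositional connectives are defined as usual. $\{x'=f(x)\}_i$ is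 the continuous game without evolution domain constraint. For the uniform substitution rule, formulas may contain predicate symbols $q(\cdot)$, interpreted arbitrarily. Semantics. State formulas $P$ denote subsets $[\![P]\!]\subseteq\mathcal S$ and game formulas $\pi$ denote subsets $[\![\pi]\!]\subseteq\mathcal S\times\mathcal C$: - $[\![e\ge\tilde e]\!]=\{\omega:\omega[\![e]\!]\ge\omega[\![\tilde e]\!]\}$; $\neg$ and $\wedge$ are complement and intersection (for state formulas as well as for game formulas); $[\![\forall xP]\!]=\{\omega:\omega_x^r\in[\![P]\!]\text{ for all }r\}$; $[\![\exists xP]\!]=\{\omega:\omega_x^r\in[\![P]\!]\text{ for some }r\}$; - $[\![\Diamond C:\pi]\!]=\{\omega\in\mathcal S:\exists c\in C\ (\omega,c)\in[\![\pi]\!]\}$; $[\![\Box C:\pi]\!]=\{\omega\in\mathcal S:\forall c\in C\ (\omega,c)\in[\![\pi]\!]\}$; - $[\![P^{\mathcal C}]\!]=[\![P]\!]\times\mathcal C$; $[\![\langle\![\alpha]\!\rangle(\pi)]\!]=[\![\alpha]\!]([\![\pi]\!])$; $[\![\Xi(P_1,P_2,P_3)]\!]=\{(\omega,c)\in\mathcal S\times\mathcal C:\omega\in\bigcap_{i\in c}[\![P_i]\!]\}$. Winning region function $[\![\alpha]\!](\cdot):\mathcal P(\mathcal S\times\mathcal C)\to\mathcal P(\mathcal S\times\mathcal C)$: - $[\![x:=e]\!](X)=\{(\omega,c)\in\mathcal S\times\mathcal C:(\omega_x^{\omega[\![e]\!]},c)\in X\}$. - $[\![\{x'=f(x)\&Q\}_i]\!](X)=\{(\varphi(0),c)\in\mathcal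 S\times C_i:(\varphi(r),c)\in X\text{ for some }r\ge0\text{ with }\varphi\models x'=f(x)\wedge Q\}\cup\{(\varphi(0),c)\in\mathcal S\times C_i^\complement:(\varphi(r),c)\in X\text{ for all }r\ge0\text{ with }\varphi\models x'=f(x)\wedge Q\}$, where $\varphi\models x'=f(x)\wedge Q$ means that $\varphi:[0,r]\to\mathcal S$ is a (differentiable) function such that $\varphi(s)\in[\![Q]\!]$ and $\frac{d\varphi(t)(x)}{dt}(s)=\varphi(s)[\![f(x)]\!]$ for all $0\le s\le r$. - $[\![?_iQ]\!](X)=\{(\omega,c)\in[\![Q^{\mathcal C}]\!]\cap X: i\in c\}\cup\{(\omega,c)\in[\![Q^{\mathcal C}]\!]^\complement\cup X: i\notin c\}$. - $[\![\alpha\cup_i\beta]\!](X)=([\![\alpha]\!](X)\cap[\![\beta]\!](X))\cup(\{(\omega,c)\in[\![\alpha]\!](X): i\in c\}\cup\{(\omega,c)\in[\![\beta]\!](X): i\in c\})$. - $[\![\alpha;\beta]\!](X)=[\![\alpha]\!]([\![\beta]\!](X))$. - $[\![\alpha^{*i}]\!](X)=\bigcap\{Z\subseteq\mathcal S\times C_i: X\cup[\![\alpha]\!](Z)\subseteq Z\}\ \cup\ \bigcup\{Z\subseteq\mathcal S\times C_i^\complement: X\cap[\![\alpha]\!](Z)\supseteq Z\}$. Proof calculus: all first-order logic rules, plus the following axioms and rules ($c$ a coalition, $C$ a set of coalitions; $\pi,\psi$ game formulas): - $\Diamond\{c\}:\langle\![x:=e]\!\rangle(\pi(x))\leftrightarrow\Diamond\{c\}:\pi(e)$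 - $\Diamond\{c\}:\langle\![?_iQ]\!\rangle(\pi)\leftrightarrow\Diamond\{c\}:(Q^{\mathcal C}\wedge\pi)$ if $i\in c$ - $\Diamond\{c\}:\langle\![?_iQ]\!\rangle(\pi)\leftrightarrow\Diamond\{c\}:(\neg Q^{\mathcal C}\vee\pi)$ if $i\notin c$ - $\Diamond\{c\}:\langle\![\{x'=f(x)\}_i]\!\rangle(\pi)\leftrightarrow\exists t{\ge}0\,\Diamond\{c\}:\langle\![x:=y(t)]\!\rangle(\pi)$ if $i\in c$, with side condition $y'=f(y)$ (that is, $y(\cdot)$ solves the differential equation) - $\Diamond\{c\}:\langle\![\{x'=f(x)\}_i]\!\rangle(\pi)\leftrightarrow\forall t{\ge}0\,\Diamond\{c\}:\langle\![x:=y(t)]\!\rangle(\pi)$ if $i\notin c$, with side condition $y'=f(y)$ - $\Diamond\{c\}:\langle\![\alpha\cup_i\beta]\!\rangle(\pi)\leftrightarrow\Diamond\{c\}:(\langle\![\alpha]\!\rangle(\pi)\vee\langle\![\beta]\!\rangle(\pi))$ if $i\in c$ - $\Diamond\{c\}:\langle\![\alpha\cup_i\beta]\!\rangle(\pi)\leftrightarrow\Diamond\{c\}:(\langle\![\alpha]\!\rangle(\pi)\wedge\langle\![\beta]\!\rangle(\pi))$ if $i\notin c$ - $\Diamond\{c\}:\langle\![\alpha;\beta]\!\rangle(\pi)\leftrightarrow\Diamond\{c\}:\langle\![\alpha]\!\rangle(\langle\![\beta]\!\rangle(\pi))$ - $\Diamond\{c\}:\langle\![\alpha^{*i}]\!\rangle(\pi)\leftrightarrow\Diamond\{c\}:(\pi\vee\langle\![\alpha]\!\rangle(\langle\![\alpha^{*i}]\!\rangle(\pi)))$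 if $i\in c$ - $\Diamond\{c\}:\langle\![\alpha^{*i}]\!\rangle(\pi)\leftrightarrow\Diamond\{c\}:(\pi\wedge\langle\![\alpha]\!\rangle(\langle\![\alpha^{*i}]\!\rangle(\pi)))$ if $i\notin c$ - from $\Diamond\{c\}:(\pi\vee\langle\![\alpha]\!\rangle(\psi)\to\psi)$ infer $\Diamond\{c\}:(\langle\![\alpha^{*i}]\!\rangle(\pi)\to\psi)$, if $i\in c$ - from $\Diamond\{c\}:(\pi\to\langle\![\alpha]\!\rangle(\pi))$ infer $\Diamond\{c\}:(\pi\to\langle\![\alpha^{*i}]\!\rangle(\pi))$, if $i\notin c$ - from $\Diamond\{c\}:(\pi\to\psi)$ infer $\Diamond\{c\}:(\langle\![\alpha]\!\rangle(\pi)\to\langle\![\alpha]\!\rangle(\psi))$ - $\Diamond(C\cup\{c\}):\pi\leftrightarrow\Diamond C:\pi\vee\Diamond\{c\}:\pi$ - $\Diamond C:\Xi(P_1,P_2,P_3)\leftrightarrow\bigvee_{c\in C}\bigwedge_{i\in c}P_i$ - $\Diamond C:P^{\mathcal C}\leftrightarrow P$ - $\Diamond C:(\pi\vee\psi)\leftrightarrow\Diamond C:\pi\vee\Diamond C:\psi$ - $\neg\Diamond C:\neg\pi\leftrightarrow\Box C:\pi$ - $\Diamond\{c\}:\pi\leftrightarrow\Box\{c\}:\pi$ - uniform substitution: from $P$ infer $P_{q(\cdot)}^{Q(\cdot)}$ (all occurrences of the predicate symbol $q(\cdot)$ replaced by the formula $Q(\cdot)$), where the substitution is required to be admissible, i.e.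 all variables $x$ that are replaced or occur in the replacement should not occur in the scope of a quantifier or modality binding $x$.
   Formalization: Repairs: variables other than x stay constant along φ; the loop's least fixpoint is taken inside 𝒮×C_i; ◇C:P^𝒞↔P needs C nonempty; y(0)=x, y solves for all t≥0 and t is fresh in the solution axioms. Terms are polynomials with rational constants. -}

module Defs where

open import Level using (0ℓ)
open import Data.Bool.Base using (Bool; true; not; T)
  renaming (_∧_ to _∧ᵇ_; _∨_ to _∨ᵇ_)
import Data.Bool.Properties as Bool
open import Data.Empty using (⊥)
open import Data.Fin.Base using (Fin)
open import Data.Fin.Patterns using (0F; 1F; 2F)
open import Data.Fin.Subset using (Subset; Nonempty; inside; outside; _∈_; _∉_)
open import Data.Fin.Subset.Properties using (_∈?_)
open import Data.Integer.Base using (ℤ; +_; -[1+_])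
open import Data.List.Base using (List; []; _∷_; map; foldr; filterᵇ; filter; allFin)
open import Data.Nat.Base using (ℕ; zero; suc)
open import Data.Product.Base using (Σ; ∃; Σ-syntax; _×_; _,_)
open import Data.Rational.Base using (ℚ; 0ℚ; ↥_; ↧_)
open import Data.Sum.Base using (_⊎_)
import Data.Vec.Base as Vec
open import Data.Unit.Base using (⊤)
open import Data.Vec.Base using (here; there)
import Data.Vec.Properties as Vec
open import Relation.Binary.Core using (Rel)
open import Relation.Binary.Definitions using (DecidableEquality)
open import Relation.Binary.PropositionalEquality using (_≡_; _≢_)
open import Relation.Binary.Structures using (IsTotalOrder)
open import Relation.Nullary using (¬_; does; yes; no)
open import Relation.Unary using (Pred)
open import Algebra.Core using (Op₁; Op₂)
open import Algebra.Structures using (IsCommutativeRing)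

-- ℝ is the Dedekind-complete ordered field, unique up to isomorphism.
record CompleteOrderedField : Set₁ where
  infix  4 _≤_ _<_
  infixl 6 _+_ _-_
  infixl 7 _*_
  infix  8 -_
  infix  9 _⁻¹
  field
    Carrier           : Set
    _+_ _*_           : Op₂ Carrier
    -_                : Op₁ Carrier
    0# 1#             : Carrier
    _⁻¹               : Op₁ Carrier        -- unconstrained at 0#
    _≤_               : Rel Carrier 0ℓ
    isCommutativeRing : IsCommutativeRing _≡_ _+_ _*_ -_ 0# 1#
    0≢1               : 0# ≢ 1#
    *-inverseʳ        : ∀ x → x ≢ 0# → x * x ⁻¹ ≡ 1#
    isTotalOrder      : IsTotalOrder _≡_ _≤_
    +-monoˡ-≤         : ∀ {x y} z → x ≤ y → x + z ≤ y + z
    *-nonNeg          : ∀ {x y} → 0# ≤ x → 0# ≤ y → 0# ≤ x * y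

  _-_ : Op₂ Carrier
  x - y = x + (- y)

  _<_ : Rel Carrier 0ℓ
  x < y = x ≤ y × x ≢ y

  UpperBound : Pred Carrier 0ℓ → Pred Carrier 0ℓ
  UpperBound A b = ∀ x → A x → x ≤ b

  field
    supremum : (A : Pred Carrier 0ℓ) → ∃ A → ∃ (UpperBound A) →
               Σ[ s ∈ Carrier ] (UpperBound A s × (∀ b → UpperBound A b → s ≤ b))

  ∣_∣<_ : Carrier → Carrier → Set
  ∣ x ∣< ε = (- ε < x) × (x < ε)

  _∈[0,_] : Carrier → Carrier → Set
  s ∈[0, r ] = (0# ≤ s) × (s ≤ r)

  -- The derivative at s of u as a function on [0, r], hence one-sided at the
  -- end points. If r = 0 every number qualifies, so that a continuous game
  -- can always be left after duration 0.
  HasDerivativeOn[0,_] : Carrier → (Carrier → Carrier) → Carrier → Carrier → Set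
  HasDerivativeOn[0, r ] u s d =
    ∀ ε → 0# < ε → Σ[ δ ∈ Carrier ] (0# < δ ×
      (∀ s′ → s′ ∈[0, r ] → s′ ≢ s → ∣ s′ - s ∣< δ →
        ∣ (u s′ - u s) * (s′ - s) ⁻¹ - d ∣< ε))

  fromℕ : ℕ → Carrier
  fromℕ zero    = 0#
  fromℕ (suc n) = 1# + fromℕ n

  fromℤ : ℤ → Carrier
  fromℤ (+ n)    = fromℕ n
  fromℤ -[1+ n ] = - fromℕ (suc n)

  fromℚ : ℚ → Carrier
  fromℚ p = fromℤ (↥ p) * fromℤ (↧ p) ⁻¹

Player : Set
Player = Fin 3

-- The irrelevant field makes coalitions with the same members equal.
record Coalition : Set where
  constructor coalition
  field
    members   : Subset 3
    .nonempty : Nonempty members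

open Coalition public

_∈ᶜ_ _∉ᶜ_ : Player → Coalition → Set
i ∈ᶜ c = i ∈ members c
i ∉ᶜ c = i ∉ members c

-- Subsets of the finite set of coalitions, by characteristic function.
Coalitions : Set
Coalitions = Coalition → Bool

｛_｝ : Coalition → Coalitions
｛ c ｝ c′ = does (Vec.≡-dec Bool._≟_ (members c′) (members c))

_∪ᶜ_ : Coalitions → Coalitions → Coalitions
(C ∪ᶜ D) c = C c ∨ᵇ D c

allCoalitions : List Coalition
allCoalitions =
  coalition (inside  Vec.∷ outside Vec.∷ outside Vec.∷ Vec.[]) (0F , here) ∷
  coalition (outside Vec.∷ inside  Vec.∷ outside Vec.∷ Vec.[]) (1F , there here) ∷
  coalition (outside Vec.∷ outside Vec.∷ inside  Vec.∷ Vec.[]) (2F , there (there here)) ∷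
  coalition (inside  Vec.∷ inside  Vec.∷ outside Vec.∷ Vec.[]) (0F , here) ∷
  coalition (inside  Vec.∷ outside Vec.∷ inside  Vec.∷ Vec.[]) (0F , here) ∷
  coalition (outside Vec.∷ inside  Vec.∷ inside  Vec.∷ Vec.[]) (1F , there here) ∷
  coalition (inside  Vec.∷ inside  Vec.∷ inside  Vec.∷ Vec.[]) (0F , here) ∷
  []

module Logic
  (ℝ : CompleteOrderedField)
  {Var : Set} (_≟_ : DecidableEquality Var)
  {Sym : Set} (_≟ˢ_ : DecidableEquality Sym)
  where

  private
    open module ℝ = CompleteOrderedField ℝ
      using (0#; _∈[0,_]; HasDerivativeOn[0,_])
    R = ℝ.Carrier

  infixl 12 _⊕_
  infixl 13 _⊗_
  infix  11 _≥_ _≐_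
  infix  10 _^𝒞
  infix  9  ¬ᶠ_
  infixr 9  ∀[_]_ ∃[_]_ ◇_∶_ □_∶_ ⟪_⟫_ ∀[_≥0]_ ∃[_≥0]_
  infixr 8  _∧_
  infixr 7  _∨_
  infixr 6  _⇒_
  infix  5  _⇔_
  infix  14 _≔_
  infix  15 _*[_]
  infixr 13 _⨾_
  infixr 12 _∪[_]_

  data Term : Set where
    var     : Var → Term
    const   : ℚ → Term
    _⊕_ _⊗_ : Term → Term → Term

  data Kind : Set where
    state game : Kind

  mutual
    data Game : Set where
      _≔_    : Var → Term → Game
      ode    : Player → Var → Term → Formula state → Game  -- {x′ = f(x) & Q}ᵢ
      test   : Player → Formula state → Game
      _∪[_]_ : Game → Player → Game → Game
      _⨾_    : Game → Game → Game
      _*[_]  : Game → Player → Game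

    data Formula : Kind → Set where
      _≥_   : Term → Term → Formula state
      pred  : Sym → Term → Formula state
      ¬ᶠ_   : ∀ {k} → Formula k → Formula k
      _∧_   : ∀ {k} → Formula k → Formula k → Formula k
      ∀[_]_ : Var → Formula state → Formula state
      ∃[_]_ : Var → Formula state → Formula state
      ◇_∶_  : Coalitions → Formula game → Formula state
      □_∶_  : Coalitions → Formula game → Formula state
      _^𝒞   : Formula state → Formula game
      ⟪_⟫_  : Game → Formula game → Formula game
      Ξ     : (P₁ P₂ P₃ : Formula state) → Formula game

  _∨_ _⇒_ _⇔_ : ∀ {k} → Formula k → Formula k → Formula k
  P ∨ Q = ¬ᶠ (¬ᶠ P ∧ ¬ᶠ Q)
  P ⇒ Q = ¬ᶠ (P ∧ ¬ᶠ Q)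
  P ⇔ Q = (P ⇒ Q) ∧ (Q ⇒ P)

  _≐_ : Term → Term → Formula state
  e ≐ e′ = e ≥ e′ ∧ e′ ≥ e

  ⊤ᶠ ⊥ᶠ : Formula state
  ⊤ᶠ = const 0ℚ ≥ const 0ℚ
  ⊥ᶠ = ¬ᶠ ⊤ᶠ

  ⋁ ⋀ : List (Formula state) → Formula state
  ⋁ = foldr _∨_ ⊥ᶠ
  ⋀ = foldr _∧_ ⊤ᶠ

  ∀[_≥0]_ ∃[_≥0]_ : Var → Formula state → Formula state
  ∀[ t ≥0] P = ∀[ t ] (var t ≥ const 0ℚ ⇒ P)
  ∃[ t ≥0] P = ∃[ t ] (var t ≥ const 0ℚ ∧ P)

  State : Set
  State = Var → R

  _[_↦_] : State → Var → R → State
  (ω [ x ↦ r ]) y with y ≟ x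
  ... | yes _ = r
  ... | no  _ = ω y

  ⟦_⟧ᵗ : Term → State → R
  ⟦ var x ⟧ᵗ   ω = ω x
  ⟦ const q ⟧ᵗ ω = ℝ.fromℚ q
  ⟦ d ⊕ e ⟧ᵗ   ω = ⟦ d ⟧ᵗ ω ℝ.+ ⟦ e ⟧ᵗ ω
  ⟦ d ⊗ e ⟧ᵗ   ω = ⟦ d ⟧ᵗ ω ℝ.* ⟦ e ⟧ᵗ ω

  Point : Kind → Set
  Point state = State
  Point game  = State × Coalition

  Region : Set₁
  Region = Pred (Point game) 0ℓ

  Interpretation : Set₁
  Interpretation = Sym → Pred R 0ℓ

  -- φ ⊨ x′ = f(x) ∧ D on [0, r]; the values of φ outside [0, r] are irrelevant.
  -- Variables without a differential equation stay constant.
  Flow : Var → Term → Pred State 0ℓ → R → (R → State) → Set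
  Flow x f D r φ = ∀ s → s ∈[0, r ] →
    D (φ s) ×
    HasDerivativeOn[0, r ] (λ t → φ t x) s (⟦ f ⟧ᵗ (φ s)) ×
    (∀ z → z ≢ x → φ s z ≡ φ 0# z)

  -- The sets Z of the fixpoint clauses are given by characteristic functions
  -- to remain within Set; under excluded middle these are all the subsets.
  BoolRegion : Set
  BoolRegion = Point game → Bool

  ⌊_⌋ : BoolRegion → Region
  ⌊ Z ⌋ p = T (Z p)

  mutual
    ⟦_⟧ : ∀ {k} → Formula k → Interpretation → Pred (Point k) 0ℓ
    ⟦ e ≥ e′ ⟧     I ω = ⟦ e′ ⟧ᵗ ω ℝ.≤ ⟦ e ⟧ᵗ ω
    ⟦ pred q e ⟧   I ω = I q (⟦ e ⟧ᵗ ω)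
    ⟦ ¬ᶠ P ⟧       I p = ¬ ⟦ P ⟧ I p
    ⟦ P ∧ Q ⟧      I p = ⟦ P ⟧ I p × ⟦ Q ⟧ I p
    ⟦ ∀[ x ] P ⟧   I ω = ∀ r → ⟦ P ⟧ I (ω [ x ↦ r ])
    ⟦ ∃[ x ] P ⟧   I ω = Σ[ r ∈ R ] ⟦ P ⟧ I (ω [ x ↦ r ])
    ⟦ ◇ C ∶ π ⟧    I ω = Σ[ c ∈ Coalition ] (T (C c) × ⟦ π ⟧ I (ω , c))
    ⟦ □ C ∶ π ⟧    I ω = ∀ c → T (C c) → ⟦ π ⟧ I (ω , c)
    ⟦ P ^𝒞 ⟧       I (ω , c) = ⟦ P ⟧ I ω
    ⟦ ⟪ α ⟫ π ⟧    I p = ⟦ α ⟧ᵍ I (⟦ π ⟧ I) p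
    ⟦ Ξ P₁ P₂ P₃ ⟧ I (ω , c) = ∀ i → i ∈ᶜ c →
      Vec.lookup (⟦ P₁ ⟧ I Vec.∷ ⟦ P₂ ⟧ I Vec.∷ ⟦ P₃ ⟧ I Vec.∷ Vec.[]) i ω

    ⟦_⟧ᵍ : Game → Interpretation → Region → Region
    ⟦ x ≔ e ⟧ᵍ I X (ω , c) = X (ω [ x ↦ ⟦ e ⟧ᵗ ω ] , c)
    ⟦ ode i x f Q ⟧ᵍ I X (ω , c) =
        (i ∈ᶜ c × Σ[ r ∈ R ] Σ[ φ ∈ (R → State) ]
           (0# ℝ.≤ r × Flow x f (⟦ Q ⟧ I) r φ × φ 0# ≡ ω × X (φ r , c)))
      ⊎ (i ∉ᶜ c × (∀ r φ →
           0# ℝ.≤ r → Flow x f (⟦ Q ⟧ I) r φ → φ 0# ≡ ω → X (φ r , c)))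
    ⟦ test i Q ⟧ᵍ I X (ω , c) =
        (i ∈ᶜ c × ⟦ Q ⟧ I ω × X (ω , c))
      ⊎ (i ∉ᶜ c × (¬ ⟦ Q ⟧ I ω ⊎ X (ω , c)))
    ⟦ α ∪[ i ] β ⟧ᵍ I X p@(_ , c) =
        (⟦ α ⟧ᵍ I X p × ⟦ β ⟧ᵍ I X p)
      ⊎ ((⟦ α ⟧ᵍ I X p × i ∈ᶜ c) ⊎ (⟦ β ⟧ᵍ I X p × i ∈ᶜ c))
    ⟦ α ⨾ β ⟧ᵍ I X = ⟦ α ⟧ᵍ I (⟦ β ⟧ᵍ I X)
    -- The least fixpoint is formed inside 𝒮 × Cᵢ: only the part of
    -- X ∪ ⟦ α ⟧(Z) over Cᵢ has to be contained in Z ⊆ 𝒮 × Cᵢ.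
    ⟦ α *[ i ] ⟧ᵍ I X (ω , c) =
        (i ∈ᶜ c × ((Z : BoolRegion) →
           (∀ ν d → ⌊ Z ⌋ (ν , d) → i ∈ᶜ d) →
           (∀ ν d → i ∈ᶜ d → X (ν , d) ⊎ ⟦ α ⟧ᵍ I ⌊ Z ⌋ (ν , d) → ⌊ Z ⌋ (ν , d)) →
           ⌊ Z ⌋ (ω , c)))
      ⊎ (Σ[ Z ∈ BoolRegion ]
           ((∀ ν d → ⌊ Z ⌋ (ν , d) → i ∉ᶜ d) ×
            (∀ ν d → ⌊ Z ⌋ (ν , d) → X (ν , d) × ⟦ α ⟧ᵍ I ⌊ Z ⌋ (ν , d)) ×
            ⌊ Z ⌋ (ω , c)))

  Valid : Formula state → Set₁
  Valid P = ∀ I ω → ⟦ P ⟧ I ω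

  _∈ᵗ_ : Var → Term → Set
  x ∈ᵗ var y     = x ≡ y
  x ∈ᵗ const _   = ⊥
  x ∈ᵗ (d ⊕ e)   = x ∈ᵗ d ⊎ x ∈ᵗ e
  x ∈ᵗ (d ⊗ e)   = x ∈ᵗ d ⊎ x ∈ᵗ e

  -- Only quantifiers remove free occurrences: a modality need not overwrite
  -- the variables that its game can bind. The variable of a differential
  -- equation is read (for its initial value), that of an assignment is not.
  mutual
    Free : Var → ∀ {k} → Formula k → Set
    Free x (e ≥ e′)     = x ∈ᵗ e ⊎ x ∈ᵗ e′
    Free x (pred q e)   = x ∈ᵗ e
    Free x (¬ᶠ P)       = Free x P
    Free x (P ∧ Q)      = Free x P ⊎ Free x Q
    Free x (∀[ y ] P)   = x ≢ y × Free x P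
    Free x (∃[ y ] P)   = x ≢ y × Free x P
    Free x (◇ C ∶ π)    = Free x π
    Free x (□ C ∶ π)    = Free x π
    Free x (P ^𝒞)       = Free x P
    Free x (⟪ α ⟫ π)    = Freeᵍ x α ⊎ Free x π
    Free x (Ξ P₁ P₂ P₃) = Free x P₁ ⊎ Free x P₂ ⊎ Free x P₃

    Freeᵍ : Var → Game → Set
    Freeᵍ x (y ≔ e)       = x ∈ᵗ e
    Freeᵍ x (ode i y f Q) = x ≡ y ⊎ x ∈ᵗ f ⊎ Free x Q
    Freeᵍ x (test i Q)    = Free x Q
    Freeᵍ x (α ∪[ i ] β)  = Freeᵍ x α ⊎ Freeᵍ x β
    Freeᵍ x (α ⨾ β)       = Freeᵍ x α ⊎ Freeᵍ x β
    Freeᵍ x (α *[ i ])    = Freeᵍ x α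

  Binds : Game → Pred Var 0ℓ
  Binds (x ≔ e)       z = z ≡ x
  Binds (ode i x f Q) z = z ≡ x
  Binds (test i Q)    z = ⊥
  Binds (α ∪[ i ] β)  z = Binds α z ⊎ Binds β z
  Binds (α ⨾ β)       z = Binds α z ⊎ Binds β z
  Binds (α *[ i ])    z = Binds α z

  BindsNone : Game → Pred Var 0ℓ → Set
  BindsNone α U = ∀ z → U z → ¬ Binds α z

  infix 16 _[_:=_]ᵗ _[_:=_] _[_:=_]ᵍ

  _[_:=_]ᵗ : Term → Var → Term → Term
  var y [ x := e ]ᵗ with y ≟ x
  ... | yes _ = e
  ... | no  _ = var y
  const q   [ x := e ]ᵗ = const q
  (d ⊕ d′)  [ x := e ]ᵗ = d [ x := e ]ᵗ ⊕ d′ [ x := e ]ᵗ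
  (d ⊗ d′)  [ x := e ]ᵗ = d [ x := e ]ᵗ ⊗ d′ [ x := e ]ᵗ

  -- May capture variables unless the substitution is admissible.
  mutual
    _[_:=_] : ∀ {k} → Formula k → Var → Term → Formula k
    (d ≥ d′)   [ x := e ] = d [ x := e ]ᵗ ≥ d′ [ x := e ]ᵗ
    pred q d   [ x := e ] = pred q (d [ x := e ]ᵗ)
    (¬ᶠ P)     [ x := e ] = ¬ᶠ (P [ x := e ])
    (P ∧ Q)    [ x := e ] = P [ x := e ] ∧ Q [ x := e ]
    (∀[ y ] P) [ x := e ] with y ≟ x
    ... | yes _ = ∀[ y ] P
    ... | no  _ = ∀[ y ] (P [ x := e ])
    (∃[ y ] P) [ x := e ] with y ≟ x
    ... | yes _ = ∃[ y ] P
    ... | no  _ = ∃[ y ] (P [ x := e ])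
    (◇ C ∶ π)  [ x := e ] = ◇ C ∶ (π [ x := e ])
    (□ C ∶ π)  [ x := e ] = □ C ∶ (π [ x := e ])
    (P ^𝒞)     [ x := e ] = (P [ x := e ]) ^𝒞
    (⟪ α ⟫ π)  [ x := e ] = ⟪ α [ x := e ]ᵍ ⟫ (π [ x := e ])
    Ξ P₁ P₂ P₃ [ x := e ] = Ξ (P₁ [ x := e ]) (P₂ [ x := e ]) (P₃ [ x := e ])

    _[_:=_]ᵍ : Game → Var → Term → Game
    (y ≔ d)      [ x := e ]ᵍ = y ≔ (d [ x := e ]ᵗ)
    ode i y f Q  [ x := e ]ᵍ = ode i y (f [ x := e ]ᵗ) (Q [ x := e ])
    test i Q     [ x := e ]ᵍ = test i (Q [ x := e ])
    (α ∪[ i ] β) [ x := e ]ᵍ = (α [ x := e ]ᵍ) ∪[ i ] (β [ x := e ]ᵍ)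
    (α ⨾ β)      [ x := e ]ᵍ = (α [ x := e ]ᵍ) ⨾ (β [ x := e ]ᵍ)
    (α *[ i ])   [ x := e ]ᵍ = (α [ x := e ]ᵍ) *[ i ]

  -- The substitution [ x := e ] is admissible if no replaced occurrence of x is
  -- in the scope of a quantifier or game binding x or a variable of e. The
  -- scope of α is π in ⟪ α ⟫ π, β in α ⨾ β, and (the next round of) α in α *[ i ].
  Affected : Var → Term → Pred Var 0ℓ
  Affected x e z = z ≡ x ⊎ z ∈ᵗ e

  mutual
    Admissible : Var → Term → ∀ {k} → Formula k → Set
    Admissible x e (d ≥ d′)     = ⊤
    Admissible x e (pred q d)   = ⊤
    Admissible x e (¬ᶠ P)       = Admissible x e P
    Admissible x e (P ∧ Q)      = Admissible x e P × Admissible x e Q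
    Admissible x e (∀[ y ] P)   =
      y ≡ x ⊎ (Admissible x e P × (Free x P → ¬ y ∈ᵗ e))
    Admissible x e (∃[ y ] P)   =
      y ≡ x ⊎ (Admissible x e P × (Free x P → ¬ y ∈ᵗ e))
    Admissible x e (◇ C ∶ π)    = Admissible x e π
    Admissible x e (□ C ∶ π)    = Admissible x e π
    Admissible x e (P ^𝒞)       = Admissible x e P
    Admissible x e (⟪ α ⟫ π)    =
      Admissibleᵍ x e α × Admissible x e π × (Free x π → BindsNone α (Affected x e))
    Admissible x e (Ξ P₁ P₂ P₃) =
      Admissible x e P₁ × Admissible x e P₂ × Admissible x e P₃

    Admissibleᵍ : Var → Term → Game → Set
    Admissibleᵍ x e (y ≔ d)       = ⊤
    Admissibleᵍ x e (ode i y f Q) =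
      y ≢ x × Admissible x e Q × (x ∈ᵗ f ⊎ Free x Q → ¬ y ∈ᵗ e)
    Admissibleᵍ x e (test i Q)    = Admissible x e Q
    Admissibleᵍ x e (α ∪[ i ] β)  = Admissibleᵍ x e α × Admissibleᵍ x e β
    Admissibleᵍ x e (α ⨾ β)       =
      Admissibleᵍ x e α × Admissibleᵍ x e β × (Freeᵍ x β → BindsNone α (Affected x e))
    Admissibleᵍ x e (α *[ i ])    =
      Admissibleᵍ x e α × (Freeᵍ x α → BindsNone α (Affected x e))

  mutual
    Occurs : Sym → ∀ {k} → Formula k → Set
    Occurs q (e ≥ e′)     = ⊥
    Occurs q (pred p e)   = q ≡ p
    Occurs q (¬ᶠ P)       = Occurs q P
    Occurs q (P ∧ Q)      = Occurs q P ⊎ Occurs q Q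
    Occurs q (∀[ y ] P)   = Occurs q P
    Occurs q (∃[ y ] P)   = Occurs q P
    Occurs q (◇ C ∶ π)    = Occurs q π
    Occurs q (□ C ∶ π)    = Occurs q π
    Occurs q (P ^𝒞)       = Occurs q P
    Occurs q (⟪ α ⟫ π)    = Occursᵍ q α ⊎ Occurs q π
    Occurs q (Ξ P₁ P₂ P₃) = Occurs q P₁ ⊎ Occurs q P₂ ⊎ Occurs q P₃

    Occursᵍ : Sym → Game → Set
    Occursᵍ q (y ≔ e)       = ⊥
    Occursᵍ q (ode i y f Q) = Occurs q Q
    Occursᵍ q (test i Q)    = Occurs q Q
    Occursᵍ q (α ∪[ i ] β)  = Occursᵍ q α ⊎ Occursᵍ q β
    Occursᵍ q (α ⨾ β)       = Occursᵍ q α ⊎ Occursᵍ q β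
    Occursᵍ q (α *[ i ])    = Occursᵍ q α

  -- The formula Q(·) is given as a formula Q with a variable u in place of
  -- the argument, so that q(e) is replaced by Q [ u := e ].
  module _ (q : Sym) (u : Var) (Q : Formula state) where

    mutual
      usubst : ∀ {k} → Formula k → Formula k
      usubst (d ≥ e)      = d ≥ e
      usubst (pred p e) with p ≟ˢ q
      ... | yes _ = Q [ u := e ]
      ... | no  _ = pred p e
      usubst (¬ᶠ P)       = ¬ᶠ usubst P
      usubst (P ∧ P′)     = usubst P ∧ usubst P′
      usubst (∀[ y ] P)   = ∀[ y ] usubst P
      usubst (∃[ y ] P)   = ∃[ y ] usubst P
      usubst (◇ C ∶ π)    = ◇ C ∶ usubst π
      usubst (□ C ∶ π)    = □ C ∶ usubst π
      usubst (P ^𝒞)       = usubst P ^𝒞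
      usubst (⟪ α ⟫ π)    = ⟪ usubstᵍ α ⟫ usubst π
      usubst (Ξ P₁ P₂ P₃) = Ξ (usubst P₁) (usubst P₂) (usubst P₃)

      usubstᵍ : Game → Game
      usubstᵍ (y ≔ e)       = y ≔ e
      usubstᵍ (ode i y f P) = ode i y f (usubst P)
      usubstᵍ (test i P)    = test i (usubst P)
      usubstᵍ (α ∪[ i ] β)  = usubstᵍ α ∪[ i ] usubstᵍ β
      usubstᵍ (α ⨾ β)       = usubstᵍ α ⨾ usubstᵍ β
      usubstᵍ (α *[ i ])    = usubstᵍ α *[ i ]

    Parameter : Pred Var 0ℓ
    Parameter z = z ≢ u × Free z Q

    mutual
      UAdmissible : ∀ {k} → Formula k → Set
      UAdmissible (d ≥ e)      = ⊤
      UAdmissible (pred p e)   = p ≡ q → Admissible u e Q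
      UAdmissible (¬ᶠ P)       = UAdmissible P
      UAdmissible (P ∧ P′)     = UAdmissible P × UAdmissible P′
      UAdmissible (∀[ y ] P)   = UAdmissible P × (Occurs q P → ¬ Parameter y)
      UAdmissible (∃[ y ] P)   = UAdmissible P × (Occurs q P → ¬ Parameter y)
      UAdmissible (◇ C ∶ π)    = UAdmissible π
      UAdmissible (□ C ∶ π)    = UAdmissible π
      UAdmissible (P ^𝒞)       = UAdmissible P
      UAdmissible (⟪ α ⟫ π)    =
        UAdmissibleᵍ α × UAdmissible π × (Occurs q π → BindsNone α Parameter)
      UAdmissible (Ξ P₁ P₂ P₃) = UAdmissible P₁ × UAdmissible P₂ × UAdmissible P₃

      UAdmissibleᵍ : Game → Set
      UAdmissibleᵍ (y ≔ e)       = ⊤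
      UAdmissibleᵍ (ode i y f P) = UAdmissible P × (Occurs q P → ¬ Parameter y)
      UAdmissibleᵍ (test i P)    = UAdmissible P
      UAdmissibleᵍ (α ∪[ i ] β)  = UAdmissibleᵍ α × UAdmissibleᵍ β
      UAdmissibleᵍ (α ⨾ β)       =
        UAdmissibleᵍ α × UAdmissibleᵍ β × (Occursᵍ q β → BindsNone α Parameter)
      UAdmissibleᵍ (α *[ i ])    =
        UAdmissibleᵍ α × (Occursᵍ q α → BindsNone α Parameter)

  -- Propositional tautologies: true whatever truth values are given to the
  -- subformulas that are neither negations nor conjunctions.
  evaluate : (Formula state → Bool) → Formula state → Bool
  evaluate v (¬ᶠ P)  = not (evaluate v P)
  evaluate v (P ∧ Q) = evaluate v P ∧ᵇ evaluate v Q
  evaluate v P       = v P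

  Tautology : Formula state → Set
  Tautology P = ∀ v → evaluate v P ≡ true

  -- y, a term in the time variable t, is the solution of x′ = f(x) whose
  -- initial value is the value of x.
  Solution : Var → Term → Var → Term → Set
  Solution x f t y = ∀ ω →
    ⟦ y ⟧ᵗ (ω [ t ↦ 0# ]) ≡ ω x ×
    (∀ r → 0# ℝ.≤ r → Flow x f ⟦⊤⟧ r (λ s → ω [ x ↦ ⟦ y ⟧ᵗ (ω [ t ↦ s ]) ]))
    where
    ⟦⊤⟧ : Pred State 0ℓ
    ⟦⊤⟧ _ = ⊤

  FreshTime : Var → Var → Term → Formula game → Set
  FreshTime t x f π = t ≢ x × ¬ t ∈ᵗ f × ¬ Free t π

  component : (P₁ P₂ P₃ : Formula state) → Player → Formula state
  component P₁ P₂ P₃ = Vec.lookup (P₁ Vec.∷ P₂ Vec.∷ P₃ Vec.∷ Vec.[])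

  infix 3 ⊢_

  data ⊢_ : Formula state → Set where
    taut : ∀ {P} → Tautology P → ⊢ P
    mp   : ∀ {P Q} → ⊢ P ⇒ Q → ⊢ P → ⊢ Q
    gen  : ∀ {P} x → ⊢ P → ⊢ ∀[ x ] P
    inst : ∀ {P x e} → Admissible x e P → ⊢ ∀[ x ] P ⇒ P [ x := e ]
    dist : ∀ {P Q x} → ⊢ ∀[ x ] (P ⇒ Q) ⇒ ∀[ x ] P ⇒ ∀[ x ] Q
    vac  : ∀ {P x} → ¬ Free x P → ⊢ P ⇒ ∀[ x ] P
    ∃-∀  : ∀ {P x} → ⊢ ∃[ x ] P ⇔ ¬ᶠ (∀[ x ] ¬ᶠ P)
    ≐-refl  : ∀ {e} → ⊢ e ≐ e
    ≐-subst : ∀ {P x e e′} → Admissible x e P → Admissible x e′ P →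
              ⊢ e ≐ e′ ⇒ P [ x := e ] ⇒ P [ x := e′ ]

    assign  : ∀ {c x e π} → Admissible x e π →
              ⊢ ◇ ｛ c ｝ ∶ ⟪ x ≔ e ⟫ π ⇔ ◇ ｛ c ｝ ∶ (π [ x := e ])
    test∈   : ∀ {c i Q π} → i ∈ᶜ c →
              ⊢ ◇ ｛ c ｝ ∶ ⟪ test i Q ⟫ π ⇔ ◇ ｛ c ｝ ∶ (Q ^𝒞 ∧ π)
    test∉   : ∀ {c i Q π} → i ∉ᶜ c →
              ⊢ ◇ ｛ c ｝ ∶ ⟪ test i Q ⟫ π ⇔ ◇ ｛ c ｝ ∶ (¬ᶠ (Q ^𝒞) ∨ π)
    solve∈  : ∀ {c i x f t y π} → i ∈ᶜ c → Solution x f t y → FreshTime t x f π →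
              ⊢ ◇ ｛ c ｝ ∶ ⟪ ode i x f ⊤ᶠ ⟫ π ⇔ ∃[ t ≥0] ◇ ｛ c ｝ ∶ ⟪ x ≔ y ⟫ π
    solve∉  : ∀ {c i x f t y π} → i ∉ᶜ c → Solution x f t y → FreshTime t x f π →
              ⊢ ◇ ｛ c ｝ ∶ ⟪ ode i x f ⊤ᶠ ⟫ π ⇔ ∀[ t ≥0] ◇ ｛ c ｝ ∶ ⟪ x ≔ y ⟫ π
    choice∈ : ∀ {c i α β π} → i ∈ᶜ c →
              ⊢ ◇ ｛ c ｝ ∶ ⟪ α ∪[ i ] β ⟫ π ⇔ ◇ ｛ c ｝ ∶ (⟪ α ⟫ π ∨ ⟪ β ⟫ π)
    choice∉ : ∀ {c i α β π} → i ∉ᶜ c →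
              ⊢ ◇ ｛ c ｝ ∶ ⟪ α ∪[ i ] β ⟫ π ⇔ ◇ ｛ c ｝ ∶ (⟪ α ⟫ π ∧ ⟪ β ⟫ π)
    compose : ∀ {c α β π} →
              ⊢ ◇ ｛ c ｝ ∶ ⟪ α ⨾ β ⟫ π ⇔ ◇ ｛ c ｝ ∶ ⟪ α ⟫ ⟪ β ⟫ π
    unfold∈ : ∀ {c i α π} → i ∈ᶜ c →
              ⊢ ◇ ｛ c ｝ ∶ ⟪ α *[ i ] ⟫ π ⇔ ◇ ｛ c ｝ ∶ (π ∨ ⟪ α ⟫ ⟪ α *[ i ] ⟫ π)
    unfold∉ : ∀ {c i α π} → i ∉ᶜ c →
              ⊢ ◇ ｛ c ｝ ∶ ⟪ α *[ i ] ⟫ π ⇔ ◇ ｛ c ｝ ∶ (π ∧ ⟪ α ⟫ ⟪ α *[ i ] ⟫ π)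
    fp      : ∀ {c i α π ψ} → i ∈ᶜ c →
              ⊢ ◇ ｛ c ｝ ∶ (π ∨ ⟪ α ⟫ ψ ⇒ ψ) → ⊢ ◇ ｛ c ｝ ∶ (⟪ α *[ i ] ⟫ π ⇒ ψ)
    ind     : ∀ {c i α π} → i ∉ᶜ c →
              ⊢ ◇ ｛ c ｝ ∶ (π ⇒ ⟪ α ⟫ π) → ⊢ ◇ ｛ c ｝ ∶ (π ⇒ ⟪ α *[ i ] ⟫ π)
    mono    : ∀ {c α π ψ} →
              ⊢ ◇ ｛ c ｝ ∶ (π ⇒ ψ) → ⊢ ◇ ｛ c ｝ ∶ (⟪ α ⟫ π ⇒ ⟪ α ⟫ ψ)

    ◇-∪  : ∀ {C c π} → ⊢ ◇ C ∪ᶜ ｛ c ｝ ∶ π ⇔ ◇ C ∶ π ∨ ◇ ｛ c ｝ ∶ π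
    ◇-Ξ  : ∀ {C P₁ P₂ P₃} →
           ⊢ ◇ C ∶ Ξ P₁ P₂ P₃ ⇔
             ⋁ (map (λ c → ⋀ (map (component P₁ P₂ P₃)
                                  (filter (_∈? members c) (allFin 3))))
                    (filterᵇ C allCoalitions))
    -- Unsound for empty C, where the left-hand side is false.
    ◇-^𝒞 : ∀ {C P} → (Σ[ c ∈ Coalition ] T (C c)) → ⊢ ◇ C ∶ (P ^𝒞) ⇔ P
    ◇-∨  : ∀ {C π ψ} → ⊢ ◇ C ∶ (π ∨ ψ) ⇔ ◇ C ∶ π ∨ ◇ C ∶ ψ
    ◇-□  : ∀ {C π} → ⊢ ¬ᶠ (◇ C ∶ ¬ᶠ π) ⇔ □ C ∶ π
    ◇⇔□  : ∀ {c π} → ⊢ ◇ ｛ c ｝ ∶ π ⇔ □ ｛ c ｝ ∶ π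

    us : ∀ {P} q u Q → UAdmissible q u Q P → ⊢ P → ⊢ usubst q u Q P

{-# OPTIONS --safe #-}

-- A game only relates its own coalition: the winning region of α at coalition c depends on
-- the goal at c alone. Coincidence, substitution and uniform substitution are all instances
-- of one notion of simulation, which says that a relation between states is carried
-- through a game; a loop is simulated by simulating its pre- and postfixpoints. The repetition
-- axioms and rules are the Knaster–Tarski theorem at one coalition. The solution axioms need
-- that a polynomial scalar differential equation has at most one solution: as the right-hand
-- side is Lipschitz on bounded sets, two solutions that agree at a agree on some
-- [a, a + δ], and real induction (from the supremum axiom) extends this to all of [0, r].

module Submission where

open import Defs
open import Level using (0ℓ)
open import Algebra.Bundles using (CommutativeRing)
import Algebra.Properties.Ring
import Algebra.Solver.Ring
open import Algebra.Solver.Ring.AlmostCommutativeRing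
  using (fromCommutativeRing; _-Raw-AlmostCommutative⟶_)
open import Axiom.ExcludedMiddle using (ExcludedMiddle)
open import Axiom.Extensionality.Propositional using (Extensionality)
open import Data.Bool.Base using (true; false; T)
import Data.Bool.Properties as Bool
open import Data.Bool.Properties using (T?)
open import Data.Empty using (⊥-elim)
open import Data.Empty.Irrelevant using () renaming (⊥-elim to ⊥-elim-irr)
open import Data.Fin.Patterns using (0F; 1F; 2F)
open import Data.Fin.Subset using (Nonempty; inside; outside)
open import Data.Fin.Subset.Properties using (_∈?_)
import Data.Integer.Base as ℤ
import Data.Integer.Properties as ℤ
open import Data.List.Base as List using ([]; _∷_; filter; allFin)
open import Data.List.Membership.Propositional using (find; lose) renaming (_∈_ to _∈ˡ_)
open import Data.List.Membership.Propositional.Properties using (∈-filter⁺; ∈-filter⁻; ∈-allFin)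
open import Data.List.Relation.Unary.All as All using (All; []; _∷_)
import Data.List.Relation.Unary.All.Properties as All
open import Data.List.Relation.Unary.Any using (Any; here; there)
import Data.List.Relation.Unary.Any.Properties as Any
import Data.Maybe.Base as Maybe
import Data.Nat.Base as ℕ
import Data.Nat.Properties as ℕ
open import Data.Product.Base using (∃; Σ-syntax; _×_; _,_; proj₁; proj₂; map; map₂)
open import Data.Rational.Base using (0ℚ)
open import Data.Sum.Base as Sum using (_⊎_; inj₁; inj₂; [_,_]′)
open import Data.Unit.Base using (⊤; tt)
import Data.Vec.Base as Vec
open import Data.Vec.Base using () renaming (_∷_ to _∷ᵛ_; [] to []ᵛ)
import Data.Vec.Properties as Vec
open import Function.Base using (_∘_; id; flip)
open import Function.Bundles using (Equivalence)
open import Relation.Binary.Consequences using (dec⇒weaklyDec)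
open import Relation.Binary.Core using (Rel)
open import Relation.Binary.Definitions using (DecidableEquality)
open import Relation.Binary.PropositionalEquality
  using (_≡_; _≢_; refl; sym; trans; cong; cong₂; subst; module ≡-Reasoning)
open import Relation.Binary.Structures using (IsTotalOrder)
open import Relation.Nullary using (¬_; Dec; yes; no; does)
open import Relation.Unary using (Pred)

-- A game may overwrite the variables on which a relation between states relies, so the relation
-- after it may be weaker than the one before: `_~_via_` carries a pair of relations, and a loop
-- needs an intermediate one that its body preserves. Admissibility guarantees that whatever is read
-- later is still related. Both directions are proved together, because negation as well as the
-- tests and continuous games of players outside the coalition need the converse one. A premise
-- `◇ ｛ c ｝ ∶ π` says nothing about coalitions other than `c`. The sets given to the fixpoint
-- clauses are therefore made trivial there: all coalitions of player `i` for a least fixpoint,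
-- nothing for a greatest one. In uniform substitution the interpretation of the symbol is fixed
-- before play and sees only its argument. So the parameters are frozen at the initial state, and
-- the relation records which variables still have their initial values.

module OrderedField (em : ExcludedMiddle 0ℓ) (ℝ : CompleteOrderedField) where
  open CompleteOrderedField ℝ public

  commutativeRing : CommutativeRing 0ℓ 0ℓ
  commutativeRing = record { isCommutativeRing = isCommutativeRing }

  open CommutativeRing commutativeRing public
    using (+-comm; +-identityˡ; +-identityʳ; *-comm; *-assoc; *-identityˡ; *-identityʳ; zeroˡ; zeroʳ;
           -‿inverseʳ; distribʳ; +-assoc)
  open Algebra.Properties.Ring (CommutativeRing.ring commutativeRing)
    using (-0#≈0#; -‿involutive; -‿+-comm; -‿distribˡ-*; -‿distribʳ-*)
  open IsTotalOrder isTotalOrder public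
    using (total; antisym) renaming (refl to ≤-refl; reflexive to ≤-reflexive; trans to ≤-trans)

  -- The homomorphism from the integers, for the ring solver

  fromℕ-+ : ∀ m n → fromℕ (m ℕ.+ n) ≡ fromℕ m + fromℕ n
  fromℕ-+ ℕ.zero    n = sym (+-identityˡ _)
  fromℕ-+ (ℕ.suc m) n = trans (cong (1# +_) (fromℕ-+ m n)) (sym (+-assoc _ _ _))

  fromℕ-* : ∀ m n → fromℕ (m ℕ.* n) ≡ fromℕ m * fromℕ n
  fromℕ-* ℕ.zero    n = sym (zeroˡ _)
  fromℕ-* (ℕ.suc m) n = begin
    fromℕ (n ℕ.+ m ℕ.* n)             ≡⟨ fromℕ-+ n (m ℕ.* n) ⟩
    fromℕ n + fromℕ (m ℕ.* n)         ≡⟨ cong₂ _+_ (sym (*-identityˡ _)) (fromℕ-* m n) ⟩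
    1# * fromℕ n + fromℕ m * fromℕ n  ≡⟨ sym (distribʳ _ _ _) ⟩
    (1# + fromℕ m) * fromℕ n          ∎
    where open ≡-Reasoning

  fromℤ-⊖ : ∀ m n → fromℤ (m ℤ.⊖ n) ≡ fromℕ m - fromℕ n
  fromℤ-⊖ m         ℕ.zero    = sym (trans (cong (fromℕ m +_) -0#≈0#) (+-identityʳ _))
  fromℤ-⊖ ℕ.zero    (ℕ.suc n) = sym (+-identityˡ _)
  fromℤ-⊖ (ℕ.suc m) (ℕ.suc n) = begin
    fromℤ (ℕ.suc m ℤ.⊖ ℕ.suc n)           ≡⟨ cong fromℤ (ℤ.[1+m]⊖[1+n]≡m⊖n m n) ⟩
    fromℤ (m ℤ.⊖ n)                       ≡⟨ fromℤ-⊖ m n ⟩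
    a - b                                 ≡⟨ cong (_- b) (sym (+-identityˡ a)) ⟩
    0# + a - b                            ≡⟨ cong (λ z → z + a - b) (sym (-‿inverseʳ 1#)) ⟩
    1# + - 1# + a - b                     ≡⟨ cong (_- b) (+-assoc _ _ _) ⟩
    1# + (- 1# + a) - b                   ≡⟨ cong (λ z → 1# + z - b) (+-comm _ _) ⟩
    1# + (a - 1#) - b                     ≡⟨ cong (_- b) (sym (+-assoc _ _ _)) ⟩
    1# + a + - 1# - b                     ≡⟨ +-assoc _ _ _ ⟩
    1# + a + (- 1# - b)                   ≡⟨ cong (1# + a +_) (-‿+-comm 1# b) ⟩
    1# + a - (1# + b)                     ∎
    where
    open ≡-Reasoning
    a = fromℕ m
    b = fromℕ n

  fromℤ-neg : ∀ i → fromℤ (ℤ.- i) ≡ - fromℤ i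
  fromℤ-neg (ℤ.+ ℕ.zero)    = sym -0#≈0#
  fromℤ-neg (ℤ.+ (ℕ.suc n)) = refl
  fromℤ-neg ℤ.-[1+ n ]      = sym (-‿involutive _)

  fromℤ-+ : ∀ i j → fromℤ (i ℤ.+ j) ≡ fromℤ i + fromℤ j
  fromℤ-+ (ℤ.+ m)    (ℤ.+ n)    = fromℕ-+ m n
  fromℤ-+ (ℤ.+ m)    ℤ.-[1+ n ] = fromℤ-⊖ m (ℕ.suc n)
  fromℤ-+ ℤ.-[1+ m ] (ℤ.+ n)    = trans (fromℤ-⊖ n (ℕ.suc m)) (+-comm _ _)
  fromℤ-+ ℤ.-[1+ m ] ℤ.-[1+ n ] = begin
    - fromℕ (ℕ.suc (ℕ.suc (m ℕ.+ n)))      ≡⟨ cong (λ k → - fromℕ (ℕ.suc k)) (sym (ℕ.+-suc m n)) ⟩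
    - fromℕ (ℕ.suc m ℕ.+ ℕ.suc n)          ≡⟨ cong -_ (fromℕ-+ (ℕ.suc m) (ℕ.suc n)) ⟩
    - (fromℕ (ℕ.suc m) + fromℕ (ℕ.suc n))  ≡⟨ sym (-‿+-comm _ _) ⟩
    - fromℕ (ℕ.suc m) - fromℕ (ℕ.suc n)    ∎
    where open ≡-Reasoning

  fromℤ-+* : ∀ m j → fromℤ (ℤ.+ m ℤ.* j) ≡ fromℕ m * fromℤ j
  fromℤ-+* ℕ.zero    j = trans (cong fromℤ (ℤ.*-zeroˡ j)) (sym (zeroˡ _))
  fromℤ-+* (ℕ.suc m) j = begin
    fromℤ (ℤ.+ (ℕ.suc m) ℤ.* j)          ≡⟨ cong fromℤ (ℤ.suc-* (ℤ.+ m) j) ⟩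
    fromℤ (j ℤ.+ ℤ.+ m ℤ.* j)            ≡⟨ fromℤ-+ j (ℤ.+ m ℤ.* j) ⟩
    fromℤ j + fromℤ (ℤ.+ m ℤ.* j)        ≡⟨ cong₂ _+_ (sym (*-identityˡ _)) (fromℤ-+* m j) ⟩
    1# * fromℤ j + fromℕ m * fromℤ j     ≡⟨ sym (distribʳ _ _ _) ⟩
    (1# + fromℕ m) * fromℤ j             ∎
    where open ≡-Reasoning

  fromℤ-* : ∀ i j → fromℤ (i ℤ.* j) ≡ fromℤ i * fromℤ j
  fromℤ-* (ℤ.+ m)    j = fromℤ-+* m j
  fromℤ-* ℤ.-[1+ m ] j = begin
    fromℤ (ℤ.- ℤ.+ (ℕ.suc m) ℤ.* j)      ≡⟨ cong fromℤ (sym (ℤ.neg-distribˡ-* (ℤ.+ (ℕ.suc m)) j)) ⟩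
    fromℤ (ℤ.- (ℤ.+ (ℕ.suc m) ℤ.* j))    ≡⟨ fromℤ-neg (ℤ.+ (ℕ.suc m) ℤ.* j) ⟩
    - fromℤ (ℤ.+ (ℕ.suc m) ℤ.* j)        ≡⟨ cong -_ (fromℤ-+* (ℕ.suc m) j) ⟩
    - (fromℕ (ℕ.suc m) * fromℤ j)        ≡⟨ -‿distribˡ-* _ _ ⟩
    - fromℕ (ℕ.suc m) * fromℤ j          ∎
    where open ≡-Reasoning

  -- The solver has to compute equality of coefficients. This works for integers but not for
  -- abstract reals, so numerals are read along this homomorphism.
  fromℤ-morphism : ℤ.+-*-rawRing -Raw-AlmostCommutative⟶ fromCommutativeRing commutativeRing
  fromℤ-morphism = record
    { ⟦_⟧    = fromℤ
    ; +-homo = fromℤ-+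
    ; *-homo = fromℤ-*
    ; -‿homo = fromℤ-neg
    ; 0-homo = refl
    ; 1-homo = +-identityʳ 1#
    }

  open Algebra.Solver.Ring ℤ.+-*-rawRing (fromCommutativeRing commutativeRing)
    fromℤ-morphism (λ i j → Maybe.map (cong fromℤ) (dec⇒weaklyDec ℤ._≟_ i j)) public
    using (solve; _:=_; _:+_; _:*_; _:-_; :-_; con)

  -- Order and division

  -- `with` normalises its arguments, and the normal forms of the proofs by `solve` are huge.
  opaque
    -- The pattern of most inequalities below: `z` is built from nonnegative sums and products, and
    -- its equality with the difference is left to the ring solver.
    0≤⇒≤ : ∀ {x y} z → 0# ≤ z → z ≡ y - x → x ≤ y
    0≤⇒≤ {x} {y} z 0≤z refl = subst (_≤ y) (+-identityˡ x)
      (subst (0# + x ≤_) (solve 2 (λ x y → y :- x :+ x := y) refl x y) (+-monoˡ-≤ x 0≤z))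

    ≤⇒0≤ : ∀ {x y} → x ≤ y → 0# ≤ y - x
    ≤⇒0≤ {x} {y} x≤y = subst (_≤ y - x) (-‿inverseʳ x) (+-monoˡ-≤ (- x) x≤y)

    +-nonNeg : ∀ {x y} → 0# ≤ x → 0# ≤ y → 0# ≤ x + y
    +-nonNeg {x} {y} 0≤x 0≤y =
      ≤-trans 0≤y (subst (_≤ x + y) (+-identityˡ y) (+-monoˡ-≤ y 0≤x))

    +-mono-≤ : ∀ {w x y z} → w ≤ x → y ≤ z → w + y ≤ x + z
    +-mono-≤ {w} {x} {y} {z} w≤x y≤z = 0≤⇒≤ _ (+-nonNeg (≤⇒0≤ w≤x) (≤⇒0≤ y≤z))
      (solve 4 (λ w x y z → x :- w :+ (z :- y) := x :+ z :- (w :+ y)) refl w x y z)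

    neg-mono-≤ : ∀ {x y} → x ≤ y → - y ≤ - x
    neg-mono-≤ {x} {y} x≤y = 0≤⇒≤ _ (≤⇒0≤ x≤y) (solve 2 (λ x y → y :- x := :- x :- :- y) refl x y)

    ≤0⇒0≤- : ∀ {x} → x ≤ 0# → 0# ≤ - x
    ≤0⇒0≤- {x} x≤0 = subst (_≤ - x) -0#≈0# (neg-mono-≤ x≤0)

    ≰⇒> : ∀ {x y} → ¬ x ≤ y → y < x
    ≰⇒> {x} {y} x≰y with total x y
    ... | inj₁ x≤y = ⊥-elim (x≰y x≤y)
    ... | inj₂ y≤x = y≤x , λ { refl → x≰y ≤-refl }

    <⇒≱ : ∀ {x y} → x < y → ¬ y ≤ x
    <⇒≱ (x≤y , x≢y) y≤x = x≢y (antisym x≤y y≤x)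

    <-≤-trans : ∀ {x y z} → x < y → y ≤ z → x < z
    <-≤-trans x<y y≤z = ≤-trans (proj₁ x<y) y≤z , λ { refl → <⇒≱ x<y y≤z }

    <⇒0< : ∀ {x y} → x < y → 0# < y - x
    <⇒0< {x} {y} (x≤y , x≢y) = ≤⇒0≤ x≤y , λ 0≡y-x → x≢y (begin
      x            ≡⟨ sym (+-identityˡ x) ⟩
      0# + x       ≡⟨ cong (_+ x) 0≡y-x ⟩
      y - x + x    ≡⟨ solve 2 (λ x y → y :- x :+ x := y) refl x y ⟩
      y            ∎)
      where open ≡-Reasoning

    0<⇒< : ∀ {x y} z → 0# < z → z ≡ y - x → x < y
    0<⇒< {x} {y} z (0≤z , 0≢z) z≡y-x = 0≤⇒≤ z 0≤z z≡y-x , λ { refl →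
      0≢z (sym (trans z≡y-x (-‿inverseʳ x))) }

    0≤1 : 0# ≤ 1#
    0≤1 with total 0# 1#
    ... | inj₁ 0≤1 = 0≤1
    -- Then `- 1#` is nonnegative, and so is its square, which is `1#`.
    ... | inj₂ 1≤0 = subst (0# ≤_)
      (trans (solve 1 (λ o → :- o :* :- o := o :* o) refl 1#) (*-identityˡ 1#))
      (*-nonNeg (≤0⇒0≤- 1≤0) (≤0⇒0≤- 1≤0))

  opaque
    0<1 : 0# < 1#
    0<1 = 0≤1 , 0≢1

    halve-nonNeg : ∀ {x} → 0# ≤ x + x → 0# ≤ x
    halve-nonNeg {x} 0≤x+x with total 0# x
    ... | inj₁ 0≤x = 0≤x
    ... | inj₂ x≤0 = subst (0# ≤_) (solve 1 (λ x → x :+ x :- x := x) refl x) (+-nonNeg 0≤x+x (≤0⇒0≤- x≤0))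

    0<+ : ∀ {x y} → 0# < x → 0# ≤ y → 0# < x + y
    0<+ {x} {y} 0<x 0≤y = <-≤-trans 0<x (0≤⇒≤ y 0≤y (solve 2 (λ x y → y := x :+ y :- x) refl x y))

    *-pos : ∀ {x y} → 0# < x → 0# < y → 0# < x * y
    *-pos {x} {y} (0≤x , 0≢x) (0≤y , 0≢y) = *-nonNeg 0≤x 0≤y , λ 0≡x*y → 0≢x (begin
      0#               ≡⟨ sym (zeroˡ _) ⟩
      0# * y ⁻¹        ≡⟨ cong (_* y ⁻¹) 0≡x*y ⟩
      x * y * y ⁻¹     ≡⟨ *-assoc _ _ _ ⟩
      x * (y * y ⁻¹)   ≡⟨ cong (x *_) (*-inverseʳ y (λ y≡0 → 0≢y (sym y≡0))) ⟩
      x * 1#           ≡⟨ *-comm _ _ ⟩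
      1# * x           ≡⟨ *-identityˡ _ ⟩
      x                ∎)
      where open ≡-Reasoning

    ⁻¹-pos : ∀ {x} → 0# < x → 0# < x ⁻¹
    -- Otherwise `x * (- x ⁻¹)`, which is `- 1#`, would be nonnegative.
    ⁻¹-pos {x} (0≤x , 0≢x) = ≰⇒> λ x⁻¹≤0 → <⇒≱ 0<1
      (0≤⇒≤ _ (*-nonNeg 0≤x (≤0⇒0≤- x⁻¹≤0))
        (trans (sym (-‿distribʳ-* x (x ⁻¹)))
          (trans (cong -_ (*-inverseʳ x (λ x≡0 → 0≢x (sym x≡0)))) (sym (+-identityˡ _)))))

  opaque
    -- Dividing by `1# + K` rather than by `K` covers `K ≡ 0#`, and `ε + ε * K = c` yields both
    -- bounds at once.
    shrink : ∀ {c K} → 0# < c → 0# ≤ K → Σ[ ε ∈ Carrier ] (0# < ε × ε ≤ c × ε * K < c)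
    shrink {c} {K} 0<c 0≤K = c * (1# + K) ⁻¹ , smaller (*-pos 0<c (⁻¹-pos 0<1+K)) (begin
      c * (1# + K) ⁻¹ * (1# + K)    ≡⟨ solve 3 (λ c K i → c :* i :* K := c :* (K :* i)) refl c (1# + K) ((1# + K) ⁻¹) ⟩
      c * ((1# + K) * (1# + K) ⁻¹)  ≡⟨ cong (c *_) (*-inverseʳ _ (λ eq → proj₂ 0<1+K (sym eq))) ⟩
      c * 1#                        ≡⟨ trans (*-comm _ _) (*-identityˡ _) ⟩
      c                             ∎)
      where
      open ≡-Reasoning
      0<1+K : 0# < 1# + K
      0<1+K = 0<+ 0<1 0≤K
      smaller : ∀ {ε} → 0# < ε → ε * (1# + K) ≡ c → 0# < ε × ε ≤ c × ε * K < c
      smaller {ε} 0<ε ε[1+K]≡c = 0<ε ,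
        0≤⇒≤ (ε * K) (*-nonNeg (proj₁ 0<ε) 0≤K)
          (trans (solve 3 (λ o ε K → ε :* K := ε :* (o :+ K) :- o :* ε) refl 1# ε K)
            (cong₂ _-_ ε[1+K]≡c (*-identityˡ ε))) ,
        0<⇒< ε 0<ε
          (trans (sym (*-identityˡ ε))
            (trans (solve 3 (λ o ε K → o :* ε := ε :* (o :+ K) :- ε :* K) refl 1# ε K)
              (cong (_- ε * K) ε[1+K]≡c)))

    min-pos : ∀ {x y} → 0# < x → 0# < y → Σ[ z ∈ Carrier ] (0# < z × z ≤ x × z ≤ y)
    min-pos {x} {y} 0<x 0<y with total x y
    ... | inj₁ x≤y = x , 0<x , ≤-refl , x≤y
    ... | inj₂ y≤x = y , 0<y , y≤x , ≤-refl

  opaque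
    -- If `x` exceeded `y`, some `ε` would make `ε * K` smaller than the gap `x - y`.
    ≤-+ε : ∀ {x y K} → 0# ≤ K → (∀ ε → 0# < ε → x ≤ y + ε * K) → x ≤ y
    ≤-+ε {x} {y} {K} 0≤K x≤y+εK with em {x ≤ y}
    ... | yes x≤y = x≤y
    ... | no  x≰y with shrink (<⇒0< (≰⇒> x≰y)) 0≤K
    ...   | ε , 0<ε , _ , εK<x-y = ⊥-elim (<⇒≱ εK<x-y (0≤⇒≤ _ (≤⇒0≤ (x≤y+εK ε 0<ε))
      (solve 3 (λ x y z → y :+ z :- x := z :- (x :- y)) refl x y (ε * K))))

  -- Bounds on absolute values

  infix 4 ∣_∣≤_
  -- A relation with an explicit bound takes the place of an absolute value function, so that
  -- estimates compose without case distinctions on signs.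
  ∣_∣≤_ : Carrier → Carrier → Set
  ∣ x ∣≤ e = (- e ≤ x) × (x ≤ e)

  opaque
    ∣∣≤⇒0≤ : ∀ {x e} → ∣ x ∣≤ e → 0# ≤ e
    ∣∣≤⇒0≤ {x} {e} (-e≤x , x≤e) = halve-nonNeg (subst (0# ≤_)
      (solve 2 (λ x e → x :- :- e :+ (e :- x) := e :+ e) refl x e)
      (+-nonNeg (≤⇒0≤ -e≤x) (≤⇒0≤ x≤e)))

    ∣0∣≤ : ∀ {e} → 0# ≤ e → ∣ 0# ∣≤ e
    ∣0∣≤ {e} 0≤e = subst (- e ≤_) -0#≈0# (neg-mono-≤ 0≤e) , 0≤e

    ∣∣≤0⇒≡0 : ∀ {x} → ∣ x ∣≤ 0# → x ≡ 0#
    ∣∣≤0⇒≡0 {x} (-0≤x , x≤0) = antisym x≤0 (subst (_≤ x) -0#≈0# -0≤x)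

    ∣∣≤-nonNeg : ∀ {x e} → 0# ≤ x → x ≤ e → ∣ x ∣≤ e
    ∣∣≤-nonNeg {x} {e} 0≤x x≤e =
      ≤-trans (subst (- e ≤_) -0#≈0# (neg-mono-≤ (≤-trans 0≤x x≤e))) 0≤x , x≤e

    ∣∣≤-bound : ∀ x → ∃ (∣ x ∣≤_)
    ∣∣≤-bound x with total 0# x
    ... | inj₁ 0≤x = x , ∣∣≤-nonNeg 0≤x ≤-refl
    ... | inj₂ x≤0 = - x , ≤-reflexive (-‿involutive x) , ≤-trans x≤0 (≤0⇒0≤- x≤0)

    ∣∣≤-trans : ∀ {x d e} → ∣ x ∣≤ d → d ≤ e → ∣ x ∣≤ e
    ∣∣≤-trans (-d≤x , x≤d) d≤e = ≤-trans (neg-mono-≤ d≤e) -d≤x , ≤-trans x≤d d≤e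

    ∣∣≤-+ : ∀ {x y d e} → ∣ x ∣≤ d → ∣ y ∣≤ e → ∣ x + y ∣≤ d + e
    ∣∣≤-+ {x} {y} {d} {e} (-d≤x , x≤d) (-e≤y , y≤e) =
      subst (_≤ x + y) (-‿+-comm d e) (+-mono-≤ -d≤x -e≤y) , +-mono-≤ x≤d y≤e

    ∣∣≤-neg : ∀ {x e} → ∣ x ∣≤ e → ∣ - x ∣≤ e
    ∣∣≤-neg {x} {e} (-e≤x , x≤e) = neg-mono-≤ x≤e , subst (- x ≤_) (-‿involutive e) (neg-mono-≤ -e≤x)

    ∣∣≤-* : ∀ {x y d e} → ∣ x ∣≤ d → ∣ y ∣≤ e → ∣ x * y ∣≤ d * e
    ∣∣≤-* {x} {y} {d} {e} (-d≤x , x≤d) (-e≤y , y≤e) =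
      -- Twice the claim is (d - x)(e - y) + (d + x)(e + y), a sum of products of nonnegative
      -- factors. The upper bound follows with `y` negated.
      0≤⇒≤ _ (halve-nonNeg (subst (0# ≤_)
        (solve 4 (λ x y d e →
            (d :- x) :* (e :- y) :+ (x :- :- d) :* (y :- :- e) :=
            x :* y :- :- (d :* e) :+ (x :* y :- :- (d :* e))) refl x y d e)
        (+-nonNeg (*-nonNeg (≤⇒0≤ x≤d) (≤⇒0≤ y≤e)) (*-nonNeg (≤⇒0≤ -d≤x) (≤⇒0≤ -e≤y))))) refl ,
      0≤⇒≤ _ (halve-nonNeg (subst (0# ≤_)
        (solve 4 (λ x y d e →
            (d :- x) :* (y :- :- e) :+ (x :- :- d) :* (e :- y) :=
            d :* e :- x :* y :+ (d :* e :- x :* y)) refl x y d e)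
        (+-nonNeg (*-nonNeg (≤⇒0≤ x≤d) (≤⇒0≤ -e≤y)) (*-nonNeg (≤⇒0≤ -d≤x) (≤⇒0≤ y≤e))))) refl

  opaque
    ∣∣≤-+ε : ∀ {x e K} → 0# ≤ K → (∀ ε → 0# < ε → ∣ x ∣≤ e + ε * K) → ∣ x ∣≤ e
    ∣∣≤-+ε {x} {e} {K} 0≤K ∣x∣≤e+εK =
      0≤⇒≤ _ (≤⇒0≤ (≤-+ε 0≤K λ ε 0<ε → 0≤⇒≤ _ (≤⇒0≤ (proj₁ (∣x∣≤e+εK ε 0<ε)))
          (solve 3 (λ x e z → x :- :- (e :+ z) := e :+ z :- :- x) refl x e (ε * K))))
        (solve 2 (λ x e → e :- :- x := x :- :- e) refl x e) ,
      ≤-+ε 0≤K λ ε 0<ε → proj₂ (∣x∣≤e+εK ε 0<ε)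

  -- Real induction

  opaque
    -- Let `s` be the supremum of the points up to which `A` holds throughout. The closing
    -- hypothesis gives `A` at `s`, and the extension hypothesis shows that nothing stops at `s`
    -- before `b`.
    real-induction : (A : Carrier → Set) {a b : Carrier} → A a →
      (∀ t → a ≤ t → t < b → A t → Σ[ δ ∈ Carrier ] (0# < δ ×
         (∀ t′ → t ≤ t′ → t′ ≤ b → t′ - t ≤ δ → A t′))) →
      (∀ t → a < t → t ≤ b → (∀ t′ → a ≤ t′ → t′ < t → A t′) → A t) →
      ∀ t → a ≤ t → t ≤ b → A t
    real-induction A {a} {b} Aa extend close t a≤t t≤b = proj₂ (proj₂ Sb) t a≤t t≤b
      where
      S : Carrier → Set
      S t = a ≤ t × t ≤ b × (∀ t′ → a ≤ t′ → t′ ≤ t → A t′)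

      a≤b : a ≤ b
      a≤b = ≤-trans a≤t t≤b

      Sa : S a
      Sa = ≤-refl , a≤b , λ t′ a≤t′ t′≤a → subst A (antisym a≤t′ t′≤a) Aa

      sup : Σ[ s ∈ Carrier ] (UpperBound S s × (∀ b → UpperBound S b → s ≤ b))
      sup = supremum S (a , Sa) (b , λ t St → proj₁ (proj₂ St))

      s : Carrier
      s = proj₁ sup

      a≤s : a ≤ s
      a≤s = proj₁ (proj₂ sup) a Sa

      s≤b : s ≤ b
      s≤b = proj₂ (proj₂ sup) b λ t St → proj₁ (proj₂ St)

      A-below : ∀ t → a ≤ t → t < s → A t
      A-below t a≤t t<s with em {Σ[ t′ ∈ Carrier ] (S t′ × t ≤ t′)}
      ... | yes (t′ , (_ , _ , At′) , t≤t′) = At′ t a≤t t≤t′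
      -- Without a point of `S` at or beyond `t`, the number `t` would be an upper bound of `S`
      -- below `s`.
      ... | no  ∄ = ⊥-elim (<⇒≱ t<s (proj₂ (proj₂ sup) t λ t′ St′ →
                      proj₁ (≰⇒> λ t≤t′ → ∄ (t′ , St′ , t≤t′))))

      As : A s
      As with em {a ≡ s}
      ... | yes a≡s = subst A a≡s Aa
      ... | no  a≢s = close s (a≤s , a≢s) s≤b A-below

      A-upto : ∀ t → a ≤ t → t ≤ s → A t
      A-upto t a≤t t≤s with em {t ≡ s}
      ... | yes refl = As
      ... | no  t≢s  = A-below t a≤t (t≤s , t≢s)

      Sb : S b
      Sb with em {s ≡ b}
      ... | yes s≡b = subst S s≡b (a≤s , s≤b , A-upto)
      -- If `s + δ` is at most `b`, it belongs to `S` and contradicts the supremum; if not, the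
      -- extension already covers everything from `s` to `b`.
      ... | no  s≢b with extend s a≤s (s≤b , s≢b) As
      ...   | δ , 0<δ , A-beyond with em {s + δ ≤ b}
      ...     | yes s+δ≤b = ⊥-elim (<⇒≱ s<s+δ (proj₁ (proj₂ sup) (s + δ)
                  (≤-trans a≤s (proj₁ s<s+δ) , s+δ≤b , λ t a≤t t≤s+δ → A-to t a≤t t≤s+δ)))
        where
        s<s+δ : s < s + δ
        s<s+δ = 0<⇒< δ 0<δ (solve 2 (λ s δ → δ := s :+ δ :- s) refl s δ)
        A-to : ∀ t → a ≤ t → t ≤ s + δ → A t
        A-to t a≤t t≤s+δ with total t s
        ... | inj₁ t≤s = A-upto t a≤t t≤s
        ... | inj₂ s≤t = A-beyond t s≤t (≤-trans t≤s+δ s+δ≤b)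
          (0≤⇒≤ _ (≤⇒0≤ t≤s+δ) (solve 3 (λ s δ t → s :+ δ :- t := δ :- (t :- s)) refl s δ t))
      ...     | no  s+δ≰b = a≤b , ≤-refl , A-to
        where
        A-to : ∀ t → a ≤ t → t ≤ b → A t
        A-to t a≤t t≤b with total t s
        ... | inj₁ t≤s = A-upto t a≤t t≤s
        ... | inj₂ s≤t = A-beyond t s≤t t≤b (≤-trans
          (0≤⇒≤ _ (≤⇒0≤ t≤b) (solve 3 (λ s b t → b :- t := b :- s :- (t :- s)) refl s b t))
          (0≤⇒≤ _ (≤⇒0≤ (proj₁ (≰⇒> s+δ≰b))) (solve 3 (λ s b δ → s :+ δ :- b := δ :- (b :- s)) refl s b δ)))

  -- Derivatives and continuity

  opaque
    <⇒∣∣≤ : ∀ {x e} → ∣ x ∣< e → ∣ x ∣≤ e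
    <⇒∣∣≤ ((-e≤x , _) , (x≤e , _)) = -e≤x , x≤e

    ∣∣≤⇒< : ∀ {x d e} → ∣ x ∣≤ d → d < e → ∣ x ∣< e
    ∣∣≤⇒< {x} {d} {e} (-d≤x , x≤d) d<e@(d≤e , d≢e) =
      <-≤-trans (neg-mono-≤ d≤e , λ -e≡-d → d≢e (begin
        d          ≡⟨ sym (-‿involutive d) ⟩
        - - d      ≡⟨ cong -_ (sym -e≡-d) ⟩
        - - e      ≡⟨ -‿involutive e ⟩
        e          ∎)) -d≤x ,
      (≤-trans x≤d d≤e , λ { refl → <⇒≱ d<e x≤d })
      where open ≡-Reasoning

    x-y≡0⇒x≡y : ∀ {x y} → x - y ≡ 0# → x ≡ y
    x-y≡0⇒x≡y {x} {y} x-y≡0 = begin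
      x            ≡⟨ solve 2 (λ x y → x := x :- y :+ y) refl x y ⟩
      x - y + y    ≡⟨ cong (_+ y) x-y≡0 ⟩
      0# + y       ≡⟨ +-identityˡ y ⟩
      y            ∎
      where open ≡-Reasoning

  opaque
    -- The derivative without division, so that `s′ ≡ s` is included. `b` is any bound on the
    -- distance and stands for the absolute value of `s′ - s`.
    linear-approximation : ∀ {r u s d} → HasDerivativeOn[0, r ] u s d → ∀ ε → 0# < ε →
      Σ[ δ ∈ Carrier ] (0# < δ × (∀ s′ b → s′ ∈[0, r ] → ∣ s′ - s ∣≤ b → b ≤ δ →
        ∣ u s′ - u s - d * (s′ - s) ∣≤ ε * b))
    linear-approximation {r} {u} {s} {d} u′≡d ε 0<ε with u′≡d ε 0<ε
    -- The quotient is controlled only at distances strictly below `δ₀`; shrinking with `K = 1#`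
    -- gives a `δ` that may itself be attained.
    ... | δ₀ , 0<δ₀ , close with shrink 0<δ₀ 0≤1
    ...   | δ , 0<δ , _ , δ1<δ₀ = δ , 0<δ , bound
      where
      open ≡-Reasoning
      bound : ∀ s′ b → s′ ∈[0, r ] → ∣ s′ - s ∣≤ b → b ≤ δ →
              ∣ u s′ - u s - d * (s′ - s) ∣≤ ε * b
      bound s′ b s′∈ ∣h∣≤b b≤δ with em {s′ ≡ s}
      ... | yes refl = subst (∣_∣≤ ε * b)
        (sym (solve 3 (λ s u d → u :- u :- d :* (s :- s) := con ℤ.0ℤ) refl s (u s) d))
        (∣0∣≤ (*-nonNeg (proj₁ 0<ε) (∣∣≤⇒0≤ ∣h∣≤b)))
      ... | no s′≢s = subst (∣_∣≤ ε * b) quotient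
        (∣∣≤-* (<⇒∣∣≤ (close s′ s′∈ s′≢s (∣∣≤⇒< ∣h∣≤b b<δ₀))) ∣h∣≤b)
        where
        h Δu : Carrier
        h = s′ - s
        Δu = u s′ - u s
        b<δ₀ : b < δ₀
        b<δ₀ = let b≤δ1 = subst (b ≤_) (sym (trans (*-comm δ 1#) (*-identityˡ δ))) b≤δ
               in ≤-trans b≤δ1 (proj₁ δ1<δ₀) , λ { refl → <⇒≱ δ1<δ₀ b≤δ1 }
        quotient : (Δu * h ⁻¹ - d) * h ≡ Δu - d * h
        quotient = begin
          (Δu * h ⁻¹ - d) * h       ≡⟨ solve 4 (λ D i d h → (D :* i :- d) :* h := D :* (h :* i) :- d :* h)
                                         refl Δu (h ⁻¹) d h ⟩
          Δu * (h * h ⁻¹) - d * h   ≡⟨ cong (λ z → Δu * z - d * h) (*-inverseʳ h (λ h≡0 → s′≢s (x-y≡0⇒x≡y h≡0))) ⟩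
          Δu * 1# - d * h           ≡⟨ cong (_- d * h) (trans (*-comm Δu 1#) (*-identityˡ Δu)) ⟩
          Δu - d * h                ∎

  opaque
    -- If `D` bounds the derivative and the approximation error has slope 1, then `u` moves by at
    -- most (1 + D)δ within distance δ.
    continuous : ∀ {r u s d} → HasDerivativeOn[0, r ] u s d → ∀ η → 0# < η →
      Σ[ δ ∈ Carrier ] (0# < δ × (∀ s′ → s′ ∈[0, r ] → ∣ s′ - s ∣≤ δ → ∣ u s′ - u s ∣≤ η))
    continuous {r} {u} {s} {d} u′≡d η 0<η
      with linear-approximation u′≡d 1# 0<1 | ∣∣≤-bound d
    ... | δ₁ , 0<δ₁ , approx | D , ∣d∣≤D
      with shrink 0<η (+-nonNeg 0≤1 (∣∣≤⇒0≤ ∣d∣≤D))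
    ... | δ₂ , 0<δ₂ , _ , (δ₂[1+D]≤η , _) with min-pos 0<δ₁ 0<δ₂
    ... | δ , 0<δ , δ≤δ₁ , δ≤δ₂ = δ , 0<δ , λ s′ s′∈ ∣h∣≤δ → ∣∣≤-trans
      (subst (∣_∣≤ 1# * δ + D * δ)
        (solve 4 (λ a b d h → a :- b :- d :* h :+ d :* h := a :- b) refl (u s′) (u s) d (s′ - s))
        (∣∣≤-+ (approx s′ δ s′∈ ∣h∣≤δ δ≤δ₁) (∣∣≤-* ∣d∣≤D ∣h∣≤δ)))
      (≤-trans
        (0≤⇒≤ _ (*-nonNeg (+-nonNeg 0≤1 (∣∣≤⇒0≤ ∣d∣≤D)) (≤⇒0≤ δ≤δ₂))
          (solve 4 (λ o D δ δ₂ → (o :+ D) :* (δ₂ :- δ) := δ₂ :* (o :+ D) :- (o :* δ :+ D :* δ)) refl 1# D δ δ₂))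
        δ₂[1+D]≤η)

  -- Polynomials are bounded and Lipschitz on bounded sets

  LocallyLipschitz : (Carrier → Carrier) → Set
  LocallyLipschitz F = ∀ N → Σ[ L ∈ Carrier ] (0# ≤ L ×
    (∀ a b e → ∣ a ∣≤ N → ∣ b ∣≤ N → ∣ a - b ∣≤ e → ∣ F a - F b ∣≤ L * e))

  LocallyBounded : (Carrier → Carrier) → Set
  LocallyBounded F = ∀ N → Σ[ M ∈ Carrier ] (0# ≤ M × (∀ a → ∣ a ∣≤ N → ∣ F a ∣≤ M))

  opaque
    bounded-const : ∀ k → LocallyBounded (λ _ → k)
    bounded-const k N = let M , ∣k∣≤M = ∣∣≤-bound k in M , ∣∣≤⇒0≤ ∣k∣≤M , λ _ _ → ∣k∣≤M

    bounded-id : LocallyBounded (λ a → a)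
    -- `N` may be negative, which makes the claim vacuous, but the bound still has to be
    -- nonnegative.
    bounded-id N = let M , ∣N∣≤M = ∣∣≤-bound N in
      M , ∣∣≤⇒0≤ ∣N∣≤M , λ a ∣a∣≤N → ∣∣≤-trans ∣a∣≤N (proj₂ ∣N∣≤M)

    bounded-+ : ∀ {F G} → LocallyBounded F → LocallyBounded G → LocallyBounded (λ a → F a + G a)
    bounded-+ bF bG N =
      let M , 0≤M , F≤M = bF N
          M′ , 0≤M′ , G≤M′ = bG N
      in M + M′ , +-nonNeg 0≤M 0≤M′ , λ a ∣a∣≤N → ∣∣≤-+ (F≤M a ∣a∣≤N) (G≤M′ a ∣a∣≤N)

    bounded-* : ∀ {F G} → LocallyBounded F → LocallyBounded G → LocallyBounded (λ a → F a * G a)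
    bounded-* bF bG N =
      let M , 0≤M , F≤M = bF N
          M′ , 0≤M′ , G≤M′ = bG N
      in M * M′ , *-nonNeg 0≤M 0≤M′ , λ a ∣a∣≤N → ∣∣≤-* (F≤M a ∣a∣≤N) (G≤M′ a ∣a∣≤N)

    lipschitz-const : ∀ k → LocallyLipschitz (λ _ → k)
    lipschitz-const k N = 0# , ≤-refl , λ a b e _ _ _ →
      subst (∣_∣≤ 0# * e) (sym (-‿inverseʳ k)) (∣0∣≤ (≤-reflexive (sym (zeroˡ e))))

    lipschitz-id : LocallyLipschitz (λ a → a)
    lipschitz-id N = 1# , 0≤1 , λ a b e _ _ ∣a-b∣≤e → subst (∣ a - b ∣≤_) (sym (*-identityˡ e)) ∣a-b∣≤e

    lipschitz-+ : ∀ {F G} → LocallyLipschitz F → LocallyLipschitz G → LocallyLipschitz (λ a → F a + G a)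
    lipschitz-+ {F} {G} lF lG N =
      let L , 0≤L , F-lip = lF N
          L′ , 0≤L′ , G-lip = lG N
      in L + L′ , +-nonNeg 0≤L 0≤L′ , λ a b e ∣a∣≤N ∣b∣≤N ∣a-b∣≤e →
        subst (∣_∣≤ (L + L′) * e)
          (solve 4 (λ f g f′ g′ → f :- f′ :+ (g :- g′) := f :+ g :- (f′ :+ g′)) refl (F a) (G a) (F b) (G b))
          (∣∣≤-trans (∣∣≤-+ (F-lip a b e ∣a∣≤N ∣b∣≤N ∣a-b∣≤e) (G-lip a b e ∣a∣≤N ∣b∣≤N ∣a-b∣≤e))
            (≤-reflexive (sym (distribʳ e L L′))))

    -- By fg - f′g′ = f(g - g′) + g′(f - f′), where boundedness controls the factors `f` and `g′`.
    lipschitz-* : ∀ {F G} → LocallyBounded F → LocallyBounded G →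
      LocallyLipschitz F → LocallyLipschitz G → LocallyLipschitz (λ a → F a * G a)
    lipschitz-* {F} {G} bF bG lF lG N =
      let M , 0≤M , F≤M = bF N
          M′ , 0≤M′ , G≤M′ = bG N
          L , 0≤L , F-lip = lF N
          L′ , 0≤L′ , G-lip = lG N
      in M * L′ + M′ * L , +-nonNeg (*-nonNeg 0≤M 0≤L′) (*-nonNeg 0≤M′ 0≤L) , λ a b e ∣a∣≤N ∣b∣≤N ∣a-b∣≤e →
        subst (∣_∣≤ (M * L′ + M′ * L) * e)
          (solve 4 (λ f g f′ g′ → f :* (g :- g′) :+ g′ :* (f :- f′) := f :* g :- f′ :* g′)
            refl (F a) (G a) (F b) (G b))
          (∣∣≤-trans
            (∣∣≤-+ (∣∣≤-* (F≤M a ∣a∣≤N) (G-lip a b e ∣a∣≤N ∣b∣≤N ∣a-b∣≤e))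
                   (∣∣≤-* (G≤M′ b ∣b∣≤N) (F-lip a b e ∣a∣≤N ∣b∣≤N ∣a-b∣≤e)))
            (≤-reflexive (solve 5 (λ m l m′ l′ e → m :* (l′ :* e) :+ m′ :* (l :* e) := (m :* l′ :+ m′ :* l) :* e)
              refl M L M′ L′ e)))

  -- Uniqueness of solutions of a scalar differential equation

  module _ {F : Carrier → Carrier} (lipschitz : LocallyLipschitz F) {r : Carrier} {u v : Carrier → Carrier}
    (u′ : ∀ s → s ∈[0, r ] → HasDerivativeOn[0, r ] u s (F (u s)))
    (v′ : ∀ s → s ∈[0, r ] → HasDerivativeOn[0, r ] v s (F (v s)))
    where

    private
      w : Carrier → Carrier
      w t = u t - v t

    opaque
      -- By continuity, `u` and `v` each move by at most `ε` between `t - δ` and `t`, so the bound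
      -- just before `t` is missed by at most 2ε. This closes both real inductions below: `K` is the
      -- slope of the barrier in one and `0#` in the other.
      close-bound : ∀ {a t K} → 0# ≤ a → a < t → t ≤ r → 0# ≤ K →
        (∀ t′ → a ≤ t′ → t′ < t → ∣ w t′ ∣≤ K * (t′ - a)) → ∣ w t ∣≤ K * (t - a)
      close-bound {a} {t} {K} 0≤a a<t t≤r 0≤K before = ∣∣≤-+ε (+-nonNeg 0≤1 0≤1) λ ε 0<ε →
        let δ₁ , 0<δ₁ , u-close = continuous (u′ t t∈) ε 0<ε
            δ₂ , 0<δ₂ , v-close = continuous (v′ t t∈) ε 0<ε
            δ₃ , 0<δ₃ , δ₃≤δ₁ , δ₃≤δ₂ = min-pos 0<δ₁ 0<δ₂
            δ , 0<δ , δ≤δ₃ , δ≤t-a = min-pos 0<δ₃ (<⇒0< a<t)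
            t′ = t - δ
            a≤t′ : a ≤ t′
            a≤t′ = 0≤⇒≤ _ (≤⇒0≤ δ≤t-a) (solve 3 (λ a t δ → t :- a :- δ := t :- δ :- a) refl a t δ)
            t′<t : t′ < t
            t′<t = 0<⇒< δ 0<δ (solve 2 (λ t δ → δ := t :- (t :- δ)) refl t δ)
            t′∈ : t′ ∈[0, r ]
            t′∈ = ≤-trans 0≤a a≤t′ , ≤-trans (proj₁ t′<t) t≤r
            ∣t′-t∣≤ : ∀ {e} → δ ≤ e → ∣ t′ - t ∣≤ e
            ∣t′-t∣≤ {e} δ≤e = subst (∣_∣≤ e) (solve 2 (λ t δ → :- δ := t :- δ :- t) refl t δ)
              (∣∣≤-neg (∣∣≤-nonNeg (proj₁ 0<δ) δ≤e))
        in ∣∣≤-trans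
             (subst (∣_∣≤ K * (t′ - a) + (ε + ε))
               (solve 4 (λ u v u′ v′ → u′ :- v′ :+ (:- (u′ :- u) :+ (v′ :- v)) := u :- v)
                 refl (u t) (v t) (u t′) (v t′))
               (∣∣≤-+ (before t′ a≤t′ t′<t)
                 (∣∣≤-+ (∣∣≤-neg (u-close t′ t′∈ (∣t′-t∣≤ (≤-trans δ≤δ₃ δ₃≤δ₁))))
                        (v-close t′ t′∈ (∣t′-t∣≤ (≤-trans δ≤δ₃ δ₃≤δ₂))))))
             (0≤⇒≤ _ (*-nonNeg 0≤K (proj₁ 0<δ)) (trans
               (solve 5 (λ K t a δ ε → K :* δ := K :* (t :- a) :+ (ε :+ ε) :- (K :* (t :- δ :- a) :+ (ε :+ ε)))
                 refl K t a δ ε)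
               (cong (λ z → K * (t - a) + z - (K * (t′ - a) + (ε + ε))) (ε+ε ε))))
        where
        t∈ : t ∈[0, r ]
        t∈ = ≤-trans 0≤a (proj₁ a<t) , t≤r
        ε+ε : ∀ ε → ε + ε ≡ ε * (1# + 1#)
        ε+ε ε = trans (cong₂ _+_ (sym (*-identityˡ ε)) (sym (*-identityˡ ε)))
          (solve 2 (λ o ε → o :* ε :+ o :* ε := ε :* (o :+ o)) refl 1# ε)

    opaque
      -- On [a, a + δ] with 2Lδ ≤ 1, where L is a Lipschitz constant, the barrier 4ε(t - a)
      -- for ∣ u - v ∣ is preserved since there ∣ u′ - v′ ∣ ≤ 2ε.
      local-uniqueness : ∀ {a} → a ∈[0, r ] → u a ≡ v a →
        Σ[ δ ∈ Carrier ] (0# < δ × (∀ t → a ≤ t → t ≤ r → t - a ≤ δ → u t ≡ v t))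
      local-uniqueness {a} a∈@(0≤a , a≤r) ua≡va
        -- Near `a` both solutions stay within 1 of their common value, hence within `1# + M` of
        -- zero; `L` is the Lipschitz constant there.
        with continuous (u′ a a∈) 1# 0<1 | continuous (v′ a a∈) 1# 0<1 | ∣∣≤-bound (u a)
      ... | δ₁ , 0<δ₁ , u-close | δ₂ , 0<δ₂ , v-close | M , ∣ua∣≤M with lipschitz (1# + M)
      ... | L , 0≤L , lip with shrink 0<1 (+-nonNeg 0≤L 0≤L) | min-pos 0<δ₁ 0<δ₂
      ... | δ₃ , 0<δ₃ , _ , (δ₃2L≤1 , _) | δ₄ , 0<δ₄ , δ₄≤δ₁ , δ₄≤δ₂ with min-pos 0<δ₃ 0<δ₄
      ... | δ , 0<δ , δ≤δ₃ , δ≤δ₄ = δ , 0<δ , agree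
        where
        module _ {b : Carrier} (b≤r : b ≤ r) (b-a≤δ : b - a ≤ δ) where
          near : ∀ {t e} → a ≤ t → t ≤ b → δ ≤ e → ∣ t - a ∣≤ e
          near {t} {e} a≤t t≤b δ≤e = ∣∣≤-nonNeg (≤⇒0≤ a≤t) (≤-trans (+-monoˡ-≤ (- a) t≤b) (≤-trans b-a≤δ δ≤e))

          u-bounded : ∀ {t} → a ≤ t → t ≤ b → ∣ u t ∣≤ 1# + M
          u-bounded {t} a≤t t≤b = subst (∣_∣≤ 1# + M) (solve 2 (λ x y → x :- y :+ y := x) refl (u t) (u a))
            (∣∣≤-+ (u-close t (≤-trans 0≤a a≤t , ≤-trans t≤b b≤r) (near a≤t t≤b (≤-trans δ≤δ₄ δ₄≤δ₁))) ∣ua∣≤M)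

          v-bounded : ∀ {t} → a ≤ t → t ≤ b → ∣ v t ∣≤ 1# + M
          v-bounded {t} a≤t t≤b = subst (∣_∣≤ 1# + M) (solve 2 (λ x y → x :- y :+ y := x) refl (v t) (v a))
            (∣∣≤-+ (v-close t (≤-trans 0≤a a≤t , ≤-trans t≤b b≤r) (near a≤t t≤b (≤-trans δ≤δ₄ δ₄≤δ₂)))
              (subst (∣_∣≤ M) ua≡va ∣ua∣≤M))

          barrier : ∀ ε → 0# < ε → ∀ t → a ≤ t → t ≤ b → ∣ w t ∣≤ (ε + ε + (ε + ε)) * (t - a)
          barrier ε 0<ε = real-induction _
            (subst (∣_∣≤ (ε + ε + (ε + ε)) * (a - a)) (sym (trans (cong (_- v a) ua≡va) (-‿inverseʳ (v a))))
              (∣0∣≤ (≤-reflexive (sym (trans (cong ((ε + ε + (ε + ε)) *_) (-‿inverseʳ a)) (zeroʳ _))))))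
            extend
            λ t a<t t≤b → close-bound 0≤a a<t (≤-trans t≤b b≤r)
              (+-nonNeg (+-nonNeg 0≤ε 0≤ε) (+-nonNeg 0≤ε 0≤ε))
            where
            0≤ε : 0# ≤ ε
            0≤ε = proj₁ 0<ε
            extend : ∀ t → a ≤ t → t < b → ∣ w t ∣≤ (ε + ε + (ε + ε)) * (t - a) →
              Σ[ δ ∈ Carrier ] (0# < δ × (∀ t′ → t ≤ t′ → t′ ≤ b → t′ - t ≤ δ →
                ∣ w t′ ∣≤ (ε + ε + (ε + ε)) * (t′ - a)))
            extend t a≤t (t≤b , _) ∣wt∣≤
              with linear-approximation (u′ t (≤-trans 0≤a a≤t , ≤-trans t≤b b≤r)) ε 0<ε
                 | linear-approximation (v′ t (≤-trans 0≤a a≤t , ≤-trans t≤b b≤r)) ε 0<ε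
            ... | η₁ , 0<η₁ , u-approx | η₂ , 0<η₂ , v-approx with min-pos 0<η₁ 0<η₂
            -- `w t′` is `w t` plus the difference of the derivatives times `h` plus two
            -- approximation errors. The barrier at `t` thus grows by at most 2εh + 2εh, which gives
            -- the barrier at `t′`.
            ... | η , 0<η , η≤η₁ , η≤η₂ = η , 0<η , λ t′ t≤t′ t′≤b t′-t≤η →
              let h = t′ - t
                  0≤h = ≤⇒0≤ t≤t′
                  ∣h∣≤h = ∣∣≤-nonNeg 0≤h ≤-refl
                  t′∈ = ≤-trans 0≤a (≤-trans a≤t t≤t′) , ≤-trans t′≤b b≤r
              in ∣∣≤-trans
                (subst (∣_∣≤ (ε + ε + (ε + ε)) * (t - a) + ((ε + ε) * h + (ε * h + ε * h)))
                  (solve 7 (λ u v u′ v′ F G h →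
                      u :- v :+ ((F :- G) :* h :+ (u′ :- u :- F :* h :+ :- (v′ :- v :- G :* h))) := u′ :- v′)
                    refl (u t) (v t) (u t′) (v t′) (F (u t)) (F (v t)) h)
                  (∣∣≤-+ ∣wt∣≤ (∣∣≤-+ (∣∣≤-* ∣Δ∣≤2ε ∣h∣≤h)
                    (∣∣≤-+ (u-approx t′ h t′∈ ∣h∣≤h (≤-trans t′-t≤η η≤η₁))
                           (∣∣≤-neg (v-approx t′ h t′∈ ∣h∣≤h (≤-trans t′-t≤η η≤η₂)))))))
                (≤-reflexive (solve 4 (λ ε t t′ a →
                    (ε :+ ε :+ (ε :+ ε)) :* (t :- a) :+ ((ε :+ ε) :* (t′ :- t) :+ (ε :* (t′ :- t) :+ ε :* (t′ :- t)))
                    := (ε :+ ε :+ (ε :+ ε)) :* (t′ :- a)) refl ε t t′ a))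
              where
              L[t-a]≤ : (t - a) * (L + L) ≤ 1#
              L[t-a]≤ = ≤-trans
                (0≤⇒≤ _ (*-nonNeg (≤⇒0≤ (≤-trans (proj₂ (near a≤t t≤b ≤-refl)) δ≤δ₃)) (+-nonNeg 0≤L 0≤L))
                  (solve 3 (λ d x l → (d :- x) :* l := d :* l :- x :* l) refl δ₃ (t - a) (L + L)))
                δ₃2L≤1
              ∣Δ∣≤2ε : ∣ F (u t) - F (v t) ∣≤ ε + ε
              -- L · 4ε(t - a) = 2ε · 2L(t - a), and 2L(t - a) is at most 1.
              ∣Δ∣≤2ε = ∣∣≤-trans (lip (u t) (v t) _ (u-bounded a≤t t≤b) (v-bounded a≤t t≤b) ∣wt∣≤)
                (0≤⇒≤ _ (*-nonNeg (+-nonNeg 0≤ε 0≤ε) (≤⇒0≤ L[t-a]≤))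
                  (trans (solve 4 (λ o ε L x → (ε :+ ε) :* (o :- x :* (L :+ L)) :=
                      o :* (ε :+ ε) :- L :* ((ε :+ ε :+ (ε :+ ε)) :* x)) refl 1# ε L (t - a))
                    (cong (_- L * ((ε + ε + (ε + ε)) * (t - a))) (*-identityˡ (ε + ε)))))

        agree : ∀ t → a ≤ t → t ≤ r → t - a ≤ δ → u t ≡ v t
        -- The slope 4ε is arbitrary, so letting `ε` tend to zero leaves zero as the bound.
        agree t a≤t t≤r t-a≤δ = x-y≡0⇒x≡y (∣∣≤0⇒≡0 (∣∣≤-+ε
          (+-nonNeg (+-nonNeg 0≤t-a 0≤t-a) (+-nonNeg 0≤t-a 0≤t-a)) λ ε 0<ε →
            ∣∣≤-trans (barrier t≤r t-a≤δ ε 0<ε t a≤t ≤-refl) (≤-reflexive (trans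
              (solve 2 (λ ε x → (ε :+ ε :+ (ε :+ ε)) :* x := ε :* (x :+ x :+ (x :+ x))) refl ε (t - a))
              (sym (+-identityˡ _))))))
          where
          0≤t-a : 0# ≤ t - a
          0≤t-a = ≤⇒0≤ a≤t

    opaque
      uniqueness : u 0# ≡ v 0# → ∀ t → t ∈[0, r ] → u t ≡ v t
      uniqueness u0≡v0 t (0≤t , t≤r) = real-induction (λ t → u t ≡ v t) u0≡v0
        (λ t 0≤t (t≤r , _) → local-uniqueness (0≤t , t≤r))
        -- Equality before `t` is a bound of slope zero, which continuity carries to `t`.
        (λ t 0<t t≤r before → x-y≡0⇒x≡y (∣∣≤0⇒≡0 (subst (∣ w t ∣≤_) (zeroˡ (t - 0#))
          (close-bound ≤-refl 0<t t≤r ≤-refl λ t′ 0≤t′ t′<t →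
            subst (∣_∣≤ 0# * (t′ - 0#)) (sym (trans (cong (_- v t′) (before t′ 0≤t′ t′<t)) (-‿inverseʳ (v t′))))
              (∣0∣≤ (≤-reflexive (sym (zeroˡ _))))))))
        t 0≤t t≤r

module Soundness (em : ExcludedMiddle 0ℓ) (ext : Extensionality 0ℓ 0ℓ) (ℝ : CompleteOrderedField)
  {Var : Set} (_≟_ : DecidableEquality Var) {Sym : Set} (_≟ˢ_ : DecidableEquality Sym) where

  open Logic ℝ _≟_ _≟ˢ_ renaming (⌊_⌋ to ⌊_⌋ᵇ)
  private
    module F = OrderedField em ℝ
    R = F.Carrier

  -- States and characteristic functions

  update-same : ∀ ω x r → (ω [ x ↦ r ]) x ≡ r
  update-same ω x r with x ≟ x
  ... | yes _   = refl
  ... | no  x≢x = ⊥-elim (x≢x refl)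

  update-other : ∀ ω {x z} r → z ≢ x → (ω [ x ↦ r ]) z ≡ ω z
  update-other ω {x} {z} r z≢x with z ≟ x
  ... | yes z≡x = ⊥-elim (z≢x z≡x)
  ... | no  _   = refl

  update-pointwise : ∀ {ν ω : State} {r} x z → (z ≢ x → ν z ≡ ω z) → (ν [ x ↦ r ]) z ≡ (ω [ x ↦ r ]) z
  update-pointwise x z ν≡ω with z ≟ x
  ... | yes _   = refl
  ... | no  z≢x = ν≡ω z≢x

  update-cong : ∀ {ν ω} x r → (∀ z → z ≢ x → ν z ≡ ω z) → ν [ x ↦ r ] ≡ ω [ x ↦ r ]
  update-cong x r ν≡ω = ext λ z → update-pointwise x z (ν≡ω z)

  -- Along a flow only `x` changes, so each state of the flow is recovered from its value of `x`.
  update-self : ∀ {φ ω} x → (∀ z → z ≢ x → φ z ≡ ω z) → φ ≡ ω [ x ↦ φ x ]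
  update-self {φ} {ω} x φ≡ω = ext λ z → lemma z
    where
    lemma : ∀ z → φ z ≡ (ω [ x ↦ φ x ]) z
    lemma z with z ≟ x
    ... | yes refl = refl
    ... | no  z≢x  = φ≡ω z z≢x

  -- The fixpoint clauses range over Boolean regions; excluded middle makes every region available
  -- to them.
  decide : Region → BoolRegion
  decide Z p = does (em {Z p})

  decide⁺ : ∀ (Z : Region) {p} → Z p → T (decide Z p)
  decide⁺ Z {p} Zp with em {Z p}
  ... | yes _  = tt
  ... | no ¬Zp = ¬Zp Zp

  decide⁻ : ∀ (Z : Region) {p} → T (decide Z p) → Z p
  decide⁻ Z {p} Tp with em {Z p}
  ... | yes Zp = Zp

  -- These operators are the clauses of `⟦_⟧ᵍ` with the meanings of the constituents as parameters.
  -- They agree with it definitionally, so all inductions on games share one lemma per construct.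
  assignᵍ : Var → Term → Region → Region
  assignᵍ x e X (ω , c) = X (ω [ x ↦ ⟦ e ⟧ᵗ ω ] , c)

  odeᵍ : Player → Var → Term → Pred State 0ℓ → Region → Region
  odeᵍ i x f D X (ω , c) =
      (i ∈ᶜ c × Σ[ r ∈ R ] Σ[ φ ∈ (R → State) ]
         (F.0# F.≤ r × Flow x f D r φ × φ F.0# ≡ ω × X (φ r , c)))
    ⊎ (i ∉ᶜ c × (∀ r φ →
         F.0# F.≤ r → Flow x f D r φ → φ F.0# ≡ ω → X (φ r , c)))

  testᵍ : Player → Pred State 0ℓ → Region → Region
  testᵍ i D X (ω , c) =
      (i ∈ᶜ c × D ω × X (ω , c))
    ⊎ (i ∉ᶜ c × (¬ D ω ⊎ X (ω , c)))

  choiceᵍ : (Region → Region) → Player → (Region → Region) → Region → Region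
  choiceᵍ Φ i Ψ X p@(_ , c) = (Φ X p × Ψ X p) ⊎ ((Φ X p × i ∈ᶜ c) ⊎ (Ψ X p × i ∈ᶜ c))

  starᵍ : (Region → Region) → Player → Region → Region
  starᵍ Φ i X (ω , c) =
      (i ∈ᶜ c × ((Z : BoolRegion) →
         (∀ ν d → ⌊ Z ⌋ᵇ (ν , d) → i ∈ᶜ d) →
         (∀ ν d → i ∈ᶜ d → X (ν , d) ⊎ Φ ⌊ Z ⌋ᵇ (ν , d) → ⌊ Z ⌋ᵇ (ν , d)) →
         ⌊ Z ⌋ᵇ (ω , c)))
    ⊎ (Σ[ Z ∈ BoolRegion ]
         ((∀ ν d → ⌊ Z ⌋ᵇ (ν , d) → i ∉ᶜ d) ×
          (∀ ν d → ⌊ Z ⌋ᵇ (ν , d) → X (ν , d) × Φ ⌊ Z ⌋ᵇ (ν , d)) ×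
          ⌊ Z ⌋ᵇ (ω , c)))

  -- Simulation between games

  Along : Rel State 0ℓ → Coalition → Region → Region → Set
  Along ρ c X Y = ∀ ν ω → ρ ν ω → X (ν , c) → Y (ω , c)

  -- `ρ` relates the states before the game, `σ` those after it.
  Simulates : (ρ σ : Rel State 0ℓ) → (Φ Ψ : Region → Region) → Set₁
  Simulates ρ σ Φ Ψ = ∀ c X Y → Along σ c X Y → Along ρ c (Φ X) (Ψ Y)

  record _~_via_ (Φ Ψ : Region → Region) (ρσ : Rel State 0ℓ × Rel State 0ℓ) : Set₁ where
    constructor bisim
    field
      to   : Simulates (proj₁ ρσ) (proj₂ ρσ) Φ Ψ
      from : Simulates (flip (proj₁ ρσ)) (flip (proj₂ ρσ)) Ψ Φ
  open _~_via_ public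

  Pointwise : Rel State 0ℓ → ∀ {k} → Rel (Point k) 0ℓ
  Pointwise ρ {state} ν       ω       = ρ ν ω
  Pointwise ρ {game}  (ν , c) (ω , d) = ρ ν ω × c ≡ d

  record _≈_via_ {k} (X Y : Pred (Point k) 0ℓ) (ρ : Rel State 0ℓ) : Set where
    constructor equiv
    field
      to   : ∀ p q → Pointwise ρ p q → X p → Y q
      from : ∀ p q → Pointwise ρ p q → Y q → X p
  open _≈_via_ public

  test-sim : ∀ {ρ σ} i {D E} → D ≈ E via ρ → (∀ ν ω → ρ ν ω → σ ν ω) →
             testᵍ i D ~ testᵍ i E via (ρ , σ)
  test-sim {ρ} {σ} i {D} {E} D≈E ρ⊆σ =
    bisim (sim ρ⊆σ (to D≈E) (from D≈E)) (sim (flip ρ⊆σ) (flip (from D≈E)) (flip (to D≈E)))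
    where
    sim : ∀ {ρ σ D E} → (∀ ν ω → ρ ν ω → σ ν ω) →
          (∀ ν ω → ρ ν ω → D ν → E ω) → (∀ ν ω → ρ ν ω → E ω → D ν) →
          Simulates ρ σ (testᵍ i D) (testᵍ i E)
    sim ρ⊆σ D→E E→D c X Y X→Y ν ω νρω (inj₁ (i∈c , Dν , Xν)) =
      inj₁ (i∈c , D→E ν ω νρω Dν , X→Y ν ω (ρ⊆σ ν ω νρω) Xν)
    sim ρ⊆σ D→E E→D c X Y X→Y ν ω νρω (inj₂ (i∉c , inj₁ ¬Dν)) =
      inj₂ (i∉c , inj₁ (¬Dν ∘ E→D ν ω νρω))
    sim ρ⊆σ D→E E→D c X Y X→Y ν ω νρω (inj₂ (i∉c , inj₂ Xν)) =
      inj₂ (i∉c , inj₂ (X→Y ν ω (ρ⊆σ ν ω νρω) Xν))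

  assign-sim : ∀ {ρ σ} x e e′ → (∀ ν ω → ρ ν ω → ⟦ e ⟧ᵗ ν ≡ ⟦ e′ ⟧ᵗ ω) →
    (∀ ν ω r → ρ ν ω → σ (ν [ x ↦ r ]) (ω [ x ↦ r ])) →
    assignᵍ x e ~ assignᵍ x e′ via (ρ , σ)
  assign-sim {ρ} {σ} x e e′ e≡e′ upd = bisim
    (λ c X Y X→Y ν ω νρω → X→Y _ _ (step ν ω νρω))
    (λ c Y X Y→X ω ν νρω → Y→X _ _ (step ν ω νρω))
    where
    step : ∀ ν ω → ρ ν ω → σ (ν [ x ↦ ⟦ e ⟧ᵗ ν ]) (ω [ x ↦ ⟦ e′ ⟧ᵗ ω ])
    step ν ω νρω = subst (λ r → σ (ν [ x ↦ ⟦ e ⟧ᵗ ν ]) (ω [ x ↦ r ])) (e≡e′ ν ω νρω) (upd ν ω _ νρω)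

  choice-sim : ∀ {ρ σ Φ Φ′ Ψ Ψ′} i → Φ ~ Φ′ via (ρ , σ) → Ψ ~ Ψ′ via (ρ , σ) →
               choiceᵍ Φ i Ψ ~ choiceᵍ Φ′ i Ψ′ via (ρ , σ)
  choice-sim i Φ~Φ′ Ψ~Ψ′ = bisim (sim (to Φ~Φ′) (to Ψ~Ψ′)) (sim (from Φ~Φ′) (from Ψ~Ψ′))
    where
    sim : ∀ {ρ σ Φ Φ′ Ψ Ψ′} → Simulates ρ σ Φ Φ′ → Simulates ρ σ Ψ Ψ′ →
          Simulates ρ σ (choiceᵍ Φ i Ψ) (choiceᵍ Φ′ i Ψ′)
    sim f g c X Y X→Y ν ω νρω (inj₁ (Φν , Ψν)) =
      inj₁ (f c X Y X→Y ν ω νρω Φν , g c X Y X→Y ν ω νρω Ψν)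
    sim f g c X Y X→Y ν ω νρω (inj₂ (inj₁ (Φν , i∈c))) =
      inj₂ (inj₁ (f c X Y X→Y ν ω νρω Φν , i∈c))
    sim f g c X Y X→Y ν ω νρω (inj₂ (inj₂ (Ψν , i∈c))) =
      inj₂ (inj₂ (g c X Y X→Y ν ω νρω Ψν , i∈c))

  compose-sim : ∀ {ρ σ τ Φ Φ′ Ψ Ψ′} → Φ ~ Φ′ via (ρ , σ) → Ψ ~ Ψ′ via (σ , τ) →
                (Φ ∘ Ψ) ~ (Φ′ ∘ Ψ′) via (ρ , τ)
  compose-sim Φ~Φ′ Ψ~Ψ′ = bisim
    (λ c X Y X→Y → to Φ~Φ′ c _ _ (to Ψ~Ψ′ c X Y X→Y))
    (λ c Y X Y→X → from Φ~Φ′ c _ _ (from Ψ~Ψ′ c Y X Y→X))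

  -- `σ` is the loop invariant: entering the loop establishes it, each round restores it, and it
  -- implies what the goal needs. Prefixpoints of the simulating loop are pulled back along `σ`,
  -- postfixpoints of the simulated loop are pushed forward.
  star-sim : ∀ {ρ σ τ Φ Ψ} i → Φ ~ Ψ via (σ , σ) →
             (∀ ν ω → ρ ν ω → σ ν ω) → (∀ ν ω → σ ν ω → τ ν ω) →
             starᵍ Φ i ~ starᵍ Ψ i via (ρ , τ)
  star-sim i Φ~Ψ ρ⊆σ σ⊆τ =
    bisim (sim (to Φ~Ψ) ρ⊆σ σ⊆τ) (sim (from Φ~Ψ) (flip ρ⊆σ) (flip σ⊆τ))
    where
    sim : ∀ {ρ σ τ Φ Ψ} → Simulates σ σ Φ Ψ →
          (∀ ν ω → ρ ν ω → σ ν ω) → (∀ ν ω → σ ν ω → τ ν ω) →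
          Simulates ρ τ (starᵍ Φ i) (starᵍ Ψ i)
    sim {ρ} {σ} {τ} {Φ} {Ψ} f ρ⊆σ σ⊆τ c X Y X→Y ν₀ ω₀ ν₀ρω₀ (inj₁ (i∈c , least)) =
      inj₁ (i∈c , λ Z Z⊆ pre →
        -- The largest region that `σ` takes into `Z` at `c`. At the other coalitions of player `i`
        -- it is everything, since the goals are compared at `c` only.
        let W : Region
            W (ν , d) = i ∈ᶜ d × (d ≡ c → ∀ ω → σ ν ω → ⌊ Z ⌋ᵇ (ω , c))
        in proj₂ (decide⁻ W (least (decide W)
             (λ ν d Wν → proj₁ (decide⁻ W Wν))
             λ { ν d i∈d (inj₁ Xν) → decide⁺ W (i∈d , λ { refl ω νσω →
                   pre ω c i∈d (inj₁ (X→Y ν ω (σ⊆τ ν ω νσω) Xν)) })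
               ; ν d i∈d (inj₂ Φν) → decide⁺ W (i∈d , λ { refl ω νσω →
                   pre ω c i∈d (inj₂ (f c _ ⌊ Z ⌋ᵇ
                     (λ ν′ ω′ ν′σω′ Wν′ → proj₂ (decide⁻ W Wν′) refl ω′ ν′σω′)
                     ν ω νσω Φν)) }) }))
             refl ω₀ (ρ⊆σ ν₀ ω₀ ν₀ρω₀))
    sim {ρ} {σ} {τ} {Φ} {Ψ} f ρ⊆σ σ⊆τ c X Y X→Y ν₀ ω₀ ν₀ρω₀ (inj₂ (Z , Z⊆ , post , Zν₀)) =
      inj₂ (decide W , (λ { ω d Wω → Z⊆ _ d (proj₂ (proj₂ (proj₂ (decide⁻ W Wω)))) }) , W-post ,
        decide⁺ W (refl , ν₀ , ρ⊆σ ν₀ ω₀ ν₀ρω₀ , Zν₀))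
      where
      -- The image of `Z` under `σ` at `c`, and empty at all other coalitions, where nothing is
      -- known about `Y`.
      W : Region
      W (ω , d) = d ≡ c × Σ[ ν ∈ State ] (σ ν ω × ⌊ Z ⌋ᵇ (ν , d))
      W-post : ∀ ω d → ⌊ decide W ⌋ᵇ (ω , d) → Y (ω , d) × Ψ ⌊ decide W ⌋ᵇ (ω , d)
      W-post ω d Wω with decide⁻ W Wω
      ... | refl , ν , νσω , Zν =
        X→Y ν ω (σ⊆τ ν ω νσω) (proj₁ (post ν d Zν)) ,
        f c _ _ (λ ν′ ω′ ν′σω′ Zν′ → decide⁺ W (refl , ν′ , ν′σω′ , Zν′)) ν ω νσω (proj₂ (post ν d Zν))

  flow-constant : ∀ {x f D r φ ω} → Flow x f D r φ → φ F.0# ≡ ω → ∀ s → s F.∈[0, r ] →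
                  ∀ z → z ≢ x → φ s z ≡ ω z
  flow-constant flow refl s s∈ z z≢x = proj₂ (proj₂ (flow s s∈)) z z≢x

  -- The values of `x` along `φ` are replayed over the other variables of `ω`; the derivative
  -- concerns only these values and is inherited. `σ` serves the evolution domain and the right-hand
  -- side throughout the flow, `τ` the goal at its end.
  flow-transfer : ∀ (ρ σ τ : Rel State 0ℓ) x f f′ (D E : Pred State 0ℓ) →
    (∀ ν ω → ρ ν ω → ν x ≡ ω x) →
    (∀ ν ω r → ρ ν ω → σ (ν [ x ↦ r ]) (ω [ x ↦ r ])) →
    (∀ ν ω r → ρ ν ω → τ (ν [ x ↦ r ]) (ω [ x ↦ r ])) →
    (∀ ν ω → σ ν ω → ⟦ f ⟧ᵗ ν ≡ ⟦ f′ ⟧ᵗ ω) →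
    (∀ ν ω → σ ν ω → D ν → E ω) →
    ∀ {ν ω r φ} → F.0# F.≤ r → ρ ν ω → Flow x f D r φ → φ F.0# ≡ ν →
    Σ[ ψ ∈ (R → State) ] (Flow x f′ E r ψ × ψ F.0# ≡ ω × τ (φ r) (ψ r))
  flow-transfer ρ σ τ x f f′ D E same upd updτ f≡f′ D→E {ν} {ω} {r} {φ} 0≤r νρω flow φ0≡ν =
    ψ , flow′ , start ,
    subst (λ χ → τ χ (ψ r)) (sym (φ≡ r (0≤r , F.≤-refl))) (updτ ν ω (φ r x) νρω)
    where
    ψ : R → State
    ψ s = ω [ x ↦ φ s x ]
    φ≡ : ∀ s → s F.∈[0, r ] → φ s ≡ ν [ x ↦ φ s x ]
    φ≡ s s∈ = update-self x (flow-constant {f = f} {D = D} flow φ0≡ν s s∈)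
    φσψ : ∀ s → s F.∈[0, r ] → σ (φ s) (ψ s)
    φσψ s s∈ = subst (λ χ → σ χ (ψ s)) (sym (φ≡ s s∈)) (upd ν ω (φ s x) νρω)
    flow′ : Flow x f′ E r ψ
    flow′ s s∈ =
      D→E _ _ (φσψ s s∈) (proj₁ (flow s s∈)) ,
      subst (λ u → F.HasDerivativeOn[0, r ] u s (⟦ f′ ⟧ᵗ (ψ s))) (ext λ t → sym (update-same ω x (φ t x)))
        (subst (F.HasDerivativeOn[0, r ] (λ t → φ t x) s) (f≡f′ _ _ (φσψ s s∈)) (proj₁ (proj₂ (flow s s∈)))) ,
      λ z z≢x → trans (update-other ω (φ s x) z≢x) (sym (update-other ω (φ F.0# x) z≢x))
    start : ψ F.0# ≡ ω
    start = ext λ z → update-start z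
      where
      update-start : ∀ z → (ω [ x ↦ φ F.0# x ]) z ≡ ω z
      update-start z with z ≟ x
      ... | yes refl = trans (cong (λ χ → χ z) φ0≡ν) (same ν ω νρω)
      ... | no  _    = refl

  ode-sim : ∀ {ρ τ : Rel State 0ℓ} (σ : Rel State 0ℓ) i x f f′ {D E : Pred State 0ℓ} →
    (∀ ν ω → ρ ν ω → ν x ≡ ω x) →
    (∀ ν ω r → ρ ν ω → σ (ν [ x ↦ r ]) (ω [ x ↦ r ])) →
    (∀ ν ω r → ρ ν ω → τ (ν [ x ↦ r ]) (ω [ x ↦ r ])) →
    (∀ ν ω → σ ν ω → ⟦ f ⟧ᵗ ν ≡ ⟦ f′ ⟧ᵗ ω) →
    D ≈ E via σ →
    odeᵍ i x f D ~ odeᵍ i x f′ E via (ρ , τ)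
  ode-sim {ρ} {τ} σ i x f f′ {D} {E} same upd updτ f≡f′ D≈E =
    bisim (sim f f′ D E forth back) (sim f′ f E D back forth)
    where
    Transfer : (ρ τ : Rel State 0ℓ) (f f′ : Term) (D E : Pred State 0ℓ) → Set
    Transfer ρ τ f f′ D E = ∀ {ν ω r φ} → F.0# F.≤ r → ρ ν ω → Flow x f D r φ → φ F.0# ≡ ν →
      Σ[ ψ ∈ (R → State) ] (Flow x f′ E r ψ × ψ F.0# ≡ ω × τ (φ r) (ψ r))
    forth : Transfer ρ τ f f′ D E
    forth = flow-transfer ρ σ τ x f f′ D E same upd updτ f≡f′ (to D≈E)
    back : Transfer (flip ρ) (flip τ) f′ f E D
    back = flow-transfer (flip ρ) (flip σ) (flip τ) x f′ f E D (λ ω ν → sym ∘ same ν ω)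
      (flip upd) (flip updτ) (λ ω ν → sym ∘ f≡f′ ν ω) (flip (from D≈E))
    sim : ∀ {ρ τ} f f′ D E → Transfer ρ τ f f′ D E → Transfer (flip ρ) (flip τ) f′ f E D →
      Simulates ρ τ (odeᵍ i x f D) (odeᵍ i x f′ E)
    sim f f′ D E forth back c X Y X→Y ν ω νρω (inj₁ (i∈c , r , φ , 0≤r , flow , φ0≡ν , Xφ)) =
      let ψ , flow′ , ψ0≡ω , φτψ = forth 0≤r νρω flow φ0≡ν
      in inj₁ (i∈c , r , ψ , 0≤r , flow′ , ψ0≡ω , X→Y _ _ φτψ Xφ)
    sim f f′ D E forth back c X Y X→Y ν ω νρω (inj₂ (i∉c , all)) = inj₂ (i∉c , λ r φ 0≤r flow φ0≡ω →
      let ψ , flow′ , ψ0≡ν , ψτφ = back 0≤r νρω flow φ0≡ω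
      in X→Y _ _ ψτφ (all r ψ 0≤r flow′ ψ0≡ν))

  -- Equivalence along a relation, for each formula construct

  ¬-equiv : ∀ {ρ k} {X Y : Pred (Point k) 0ℓ} → X ≈ Y via ρ → (λ p → ¬ X p) ≈ (λ p → ¬ Y p) via ρ
  ¬-equiv X≈Y = equiv (λ p q pρq → _∘ from X≈Y p q pρq) (λ p q pρq → _∘ to X≈Y p q pρq)

  ∧-equiv : ∀ {ρ k} {X X′ Y Y′ : Pred (Point k) 0ℓ} → X ≈ X′ via ρ → Y ≈ Y′ via ρ →
            (λ p → X p × Y p) ≈ (λ p → X′ p × Y′ p) via ρ
  ∧-equiv X≈X′ Y≈Y′ = equiv
    (λ p q pρq → map (to X≈X′ p q pρq) (to Y≈Y′ p q pρq))
    (λ p q pρq → map (from X≈X′ p q pρq) (from Y≈Y′ p q pρq))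

  ∀-equiv : ∀ {ρ σ} x {D E : Pred State 0ℓ} → (∀ ν ω r → ρ ν ω → σ (ν [ x ↦ r ]) (ω [ x ↦ r ])) →
    D ≈ E via σ → (λ ω → ∀ r → D (ω [ x ↦ r ])) ≈ (λ ω → ∀ r → E (ω [ x ↦ r ])) via ρ
  ∀-equiv x upd D≈E = equiv
    (λ ν ω νρω D r → to D≈E _ _ (upd ν ω r νρω) (D r))
    (λ ν ω νρω E r → from D≈E _ _ (upd ν ω r νρω) (E r))

  ∃-equiv : ∀ {ρ σ} x {D E : Pred State 0ℓ} → (∀ ν ω r → ρ ν ω → σ (ν [ x ↦ r ]) (ω [ x ↦ r ])) →
    D ≈ E via σ → (λ ω → Σ[ r ∈ R ] D (ω [ x ↦ r ])) ≈ (λ ω → Σ[ r ∈ R ] E (ω [ x ↦ r ])) via ρ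
  ∃-equiv x upd D≈E = equiv
    (λ ν ω νρω → map₂ λ {r} → to D≈E _ _ (upd ν ω r νρω))
    (λ ν ω νρω → map₂ λ {r} → from D≈E _ _ (upd ν ω r νρω))

  ◇-equiv : ∀ {ρ} {X Y : Region} (C : Coalitions) → X ≈ Y via ρ →
    (λ (ω : State) → Σ[ c ∈ Coalition ] (T (C c) × X (ω , c))) ≈
    (λ ω → Σ[ c ∈ Coalition ] (T (C c) × Y (ω , c))) via ρ
  ◇-equiv C X≈Y = equiv
    (λ ν ω νρω → map₂ λ {c} → map₂ (to X≈Y _ _ (νρω , refl)))
    (λ ν ω νρω → map₂ λ {c} → map₂ (from X≈Y _ _ (νρω , refl)))

  □-equiv : ∀ {ρ} {X Y : Region} (C : Coalitions) → X ≈ Y via ρ →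
    (λ (ω : State) → ∀ c → T (C c) → X (ω , c)) ≈ (λ ω → ∀ c → T (C c) → Y (ω , c)) via ρ
  □-equiv C X≈Y = equiv
    (λ ν ω νρω X c c∈C → to X≈Y _ _ (νρω , refl) (X c c∈C))
    (λ ν ω νρω Y c c∈C → from X≈Y _ _ (νρω , refl) (Y c c∈C))

  ^𝒞-equiv : ∀ {ρ D E} → D ≈ E via ρ → (λ (p : Point game) → D (proj₁ p)) ≈ (λ p → E (proj₁ p)) via ρ
  ^𝒞-equiv D≈E = equiv (λ p q pρq → to D≈E _ _ (proj₁ pρq)) (λ p q pρq → from D≈E _ _ (proj₁ pρq))

  ⟪⟫-equiv : ∀ {ρ σ Φ Ψ} {X Y : Region} → Φ ~ Ψ via (ρ , σ) → X ≈ Y via σ → Φ X ≈ Ψ Y via ρ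
  ⟪⟫-equiv Φ~Ψ X≈Y = equiv
    (λ { (ν , c) (ω , .c) (νρω , refl) → to Φ~Ψ c _ _ (λ ν ω νσω → to X≈Y _ _ (νσω , refl)) ν ω νρω })
    (λ { (ν , c) (ω , .c) (νρω , refl) → from Φ~Ψ c _ _ (λ ω ν νσω → from X≈Y _ _ (νσω , refl)) ω ν νρω })

  Ξ-equiv : ∀ {ρ D₁ D₂ D₃ E₁ E₂ E₃} → D₁ ≈ E₁ via ρ → D₂ ≈ E₂ via ρ → D₃ ≈ E₃ via ρ →
    (λ (p : Point game) → ∀ i → i ∈ᶜ proj₂ p → Vec.lookup (D₁ Vec.∷ D₂ Vec.∷ D₃ Vec.∷ Vec.[]) i (proj₁ p)) ≈
    (λ p → ∀ i → i ∈ᶜ proj₂ p → Vec.lookup (E₁ Vec.∷ E₂ Vec.∷ E₃ Vec.∷ Vec.[]) i (proj₁ p)) via ρ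
  Ξ-equiv D₁≈E₁ D₂≈E₂ D₃≈E₃ = equiv
    (λ { (ν , c) (ω , .c) (νρω , refl) D → λ
       { 0F i∈c → to D₁≈E₁ ν ω νρω (D 0F i∈c)
       ; 1F i∈c → to D₂≈E₂ ν ω νρω (D 1F i∈c)
       ; 2F i∈c → to D₃≈E₃ ν ω νρω (D 2F i∈c) } })
    (λ { (ν , c) (ω , .c) (νρω , refl) E → λ
       { 0F i∈c → from D₁≈E₁ ν ω νρω (E 0F i∈c)
       ; 1F i∈c → from D₂≈E₂ ν ω νρω (E 1F i∈c)
       ; 2F i∈c → from D₃≈E₃ ν ω νρω (E 2F i∈c) } })

  ≥-equiv : ∀ {ρ} I d d′ e e′ → (∀ ν ω → ρ ν ω → ⟦ d ⟧ᵗ ν ≡ ⟦ d′ ⟧ᵗ ω) → (∀ ν ω → ρ ν ω → ⟦ e ⟧ᵗ ν ≡ ⟦ e′ ⟧ᵗ ω) →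
            ⟦ d ≥ e ⟧ I ≈ ⟦ d′ ≥ e′ ⟧ I via ρ
  ≥-equiv I d d′ e e′ d≡d′ e≡e′ = equiv
    (λ ν ω νρω → subst id (cong₂ F._≤_ (e≡e′ ν ω νρω) (d≡d′ ν ω νρω)))
    (λ ν ω νρω → subst id (sym (cong₂ F._≤_ (e≡e′ ν ω νρω) (d≡d′ ν ω νρω))))

  pred-equiv : ∀ {ρ} I q e e′ → (∀ ν ω → ρ ν ω → ⟦ e ⟧ᵗ ν ≡ ⟦ e′ ⟧ᵗ ω) →
               ⟦ pred q e ⟧ I ≈ ⟦ pred q e′ ⟧ I via ρ
  pred-equiv I q e e′ e≡e′ = equiv
    (λ ν ω νρω → subst (I q) (e≡e′ ν ω νρω))
    (λ ν ω νρω → subst (I q) (sym (e≡e′ ν ω νρω)))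

  -- Coincidence on the free variables

  Agree : Pred Var 0ℓ → Rel State 0ℓ
  Agree V ν ω = ∀ z → V z → ν z ≡ ω z

  agree-update : ∀ {V W x} → (∀ z → W z → V z ⊎ z ≡ x) → ∀ ν ω r → Agree V ν ω →
                 Agree W (ν [ x ↦ r ]) (ω [ x ↦ r ])
  agree-update {x = x} W⊆ ν ω r ν≡ω z Wz = update-pointwise x z
    λ z≢x → [ ν≡ω z , (λ z≡x → ⊥-elim (z≢x z≡x)) ]′ (W⊆ z Wz)

  term-coincidence : ∀ {V} e → (∀ z → z ∈ᵗ e → V z) → ∀ ν ω → Agree V ν ω → ⟦ e ⟧ᵗ ν ≡ ⟦ e ⟧ᵗ ω
  term-coincidence (var x)   e⊆V ν ω ν≡ω = ν≡ω x (e⊆V x refl)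
  term-coincidence (const _) e⊆V ν ω ν≡ω = refl
  term-coincidence (d ⊕ e)   e⊆V ν ω ν≡ω =
    cong₂ F._+_ (term-coincidence d (λ z → e⊆V z ∘ inj₁) ν ω ν≡ω) (term-coincidence e (λ z → e⊆V z ∘ inj₂) ν ω ν≡ω)
  term-coincidence (d ⊗ e)   e⊆V ν ω ν≡ω =
    cong₂ F._*_ (term-coincidence d (λ z → e⊆V z ∘ inj₁) ν ω ν≡ω) (term-coincidence e (λ z → e⊆V z ∘ inj₂) ν ω ν≡ω)

  bound-or : ∀ {V : Pred Var 0ℓ} {k} (P : Formula k) y → (∀ z → z ≢ y × Free z P → V z) →
             ∀ z → Free z P → V z ⊎ z ≡ y
  bound-or P y P⊆V z z∈P with z ≟ y
  ... | yes z≡y = inj₂ z≡y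
  ... | no  z≢y = inj₁ (P⊆V z (z≢y , z∈P))

  module _ (I : Interpretation) where

    -- Games do not remove free occurrences, so the same `V` serves before and after each game.
    coincidence : ∀ {V k} (P : Formula k) → (∀ z → Free z P → V z) → ⟦ P ⟧ I ≈ ⟦ P ⟧ I via Agree V
    coincidenceᵍ : ∀ {V} α → (∀ z → Freeᵍ z α → V z) → ⟦ α ⟧ᵍ I ~ ⟦ α ⟧ᵍ I via (Agree V , Agree V)

    coincidence (d ≥ e)      P⊆V = ≥-equiv I d d e e
      (term-coincidence d λ z → P⊆V z ∘ inj₁) (term-coincidence e λ z → P⊆V z ∘ inj₂)
    coincidence (pred q e)   P⊆V = pred-equiv I q e e (term-coincidence e P⊆V)
    coincidence (¬ᶠ P)       P⊆V = ¬-equiv (coincidence P P⊆V)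
    coincidence (P ∧ Q)      P⊆V = ∧-equiv (coincidence P λ z → P⊆V z ∘ inj₁) (coincidence Q λ z → P⊆V z ∘ inj₂)
    coincidence (∀[ y ] P)   P⊆V = ∀-equiv y (agree-update λ _ → id) (coincidence P (bound-or P y P⊆V))
    coincidence (∃[ y ] P)   P⊆V = ∃-equiv y (agree-update λ _ → id) (coincidence P (bound-or P y P⊆V))
    coincidence (◇ C ∶ π)    P⊆V = ◇-equiv C (coincidence π P⊆V)
    coincidence (□ C ∶ π)    P⊆V = □-equiv C (coincidence π P⊆V)
    coincidence (P ^𝒞)       P⊆V = ^𝒞-equiv (coincidence P P⊆V)
    coincidence (⟪ α ⟫ π)    P⊆V = ⟪⟫-equiv (coincidenceᵍ α λ z → P⊆V z ∘ inj₁) (coincidence π λ z → P⊆V z ∘ inj₂)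
    coincidence (Ξ P₁ P₂ P₃) P⊆V = Ξ-equiv (coincidence P₁ λ z → P⊆V z ∘ inj₁)
      (coincidence P₂ λ z → P⊆V z ∘ inj₂ ∘ inj₁) (coincidence P₃ λ z → P⊆V z ∘ inj₂ ∘ inj₂)

    coincidenceᵍ (x ≔ e)       α⊆V = assign-sim x e e (term-coincidence e α⊆V) (agree-update λ _ → inj₁)
    coincidenceᵍ (ode i x f Q) α⊆V = ode-sim (Agree _) i x f f (λ ν ω ν≡ω → ν≡ω x (α⊆V x (inj₁ refl)))
      (agree-update λ _ → inj₁) (agree-update λ _ → inj₁)
      (term-coincidence f λ z → α⊆V z ∘ inj₂ ∘ inj₁) (coincidence Q λ z → α⊆V z ∘ inj₂ ∘ inj₂)
    coincidenceᵍ (test i Q)    α⊆V = test-sim i (coincidence Q α⊆V) (λ _ _ → id)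
    coincidenceᵍ (α ∪[ i ] β)  α⊆V = choice-sim i
      (coincidenceᵍ α λ z → α⊆V z ∘ inj₁) (coincidenceᵍ β λ z → α⊆V z ∘ inj₂)
    coincidenceᵍ {V} (α ⨾ β)   α⊆V = compose-sim {σ = Agree V}
      (coincidenceᵍ α λ z → α⊆V z ∘ inj₁) (coincidenceᵍ β λ z → α⊆V z ∘ inj₂)
    coincidenceᵍ {V} (α *[ i ]) α⊆V = star-sim {σ = Agree V} i (coincidenceᵍ α α⊆V) (λ _ _ → id) (λ _ _ → id)

  -- Substitution of a term for a variable

  module _ (x : Var) (e : Term) where

    -- A is the condition under which x is read later on; without it a game may have bound x
    -- or a variable of e, so that nothing is known about the value of x.
    Substituted : Set → Rel State 0ℓ
    Substituted A ν ω = (∀ z → z ≢ x → ν z ≡ ω z) × (A → ν x ≡ ⟦ e ⟧ᵗ ω)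

    substituted-update : ∀ {A B : Set} y → (B → A) → (B → ∀ z → Affected x e z → z ≢ y) → ∀ ν ω r →
      Substituted A ν ω → Substituted B (ν [ y ↦ r ]) (ω [ y ↦ r ])
    substituted-update y B→A B→y∉ ν ω r (ν≡ω , νx≡e) =
      (λ z z≢x → update-pointwise y z λ _ → ν≡ω z z≢x) ,
      λ b → trans (update-other ν r (B→y∉ b x (inj₁ refl))) (trans (νx≡e (B→A b))
        (term-coincidence {V = _∈ᵗ e} e (λ _ → id) _ _ λ z z∈e → sym (update-other ω r (B→y∉ b z (inj₂ z∈e)))))

    substituted-⊆ : ∀ {A B : Set} → (B → A) → ∀ ν ω → Substituted A ν ω → Substituted B ν ω
    substituted-⊆ B→A ν ω (ν≡ω , νx≡e) = ν≡ω , νx≡e ∘ B→A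

    term-substitution : ∀ {A} d → (x ∈ᵗ d → A) → ∀ ν ω → Substituted A ν ω → ⟦ d ⟧ᵗ ν ≡ ⟦ d [ x := e ]ᵗ ⟧ᵗ ω
    term-substitution (var y)   d→A ν ω (ν≡ω , νx≡e) with y ≟ x
    ... | yes refl = νx≡e (d→A refl)
    ... | no  y≢x  = ν≡ω y y≢x
    term-substitution (const _) d→A ν ω νρω = refl
    term-substitution (d ⊕ d′)  d→A ν ω νρω =
      cong₂ F._+_ (term-substitution d (d→A ∘ inj₁) ν ω νρω) (term-substitution d′ (d→A ∘ inj₂) ν ω νρω)
    term-substitution (d ⊗ d′)  d→A ν ω νρω =
      cong₂ F._*_ (term-substitution d (d→A ∘ inj₁) ν ω νρω) (term-substitution d′ (d→A ∘ inj₂) ν ω νρω)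

    avoids : ∀ {y} {B : Set} → y ≢ x → (B → ¬ y ∈ᵗ e) → B → ∀ z → Affected x e z → z ≢ y
    avoids y≢x y∉e b z (inj₁ refl) refl = y≢x refl
    avoids y≢x y∉e b z (inj₂ z∈e)  refl = y∉e b z∈e

    module _ (I : Interpretation) where

      substitution : ∀ {A k} (P : Formula k) → (Free x P → A) → Admissible x e P →
                     ⟦ P ⟧ I ≈ ⟦ P [ x := e ] ⟧ I via Substituted A
      -- `A` and `B` are the conditions under which the value of `x` is known before and after the
      -- game. Only under `B` does the game have to leave `x` and the variables of `e` alone.
      substitutionᵍ : ∀ {A B} α → (Freeᵍ x α → A) → (B → A) → (B → BindsNone α (Affected x e)) → Admissibleᵍ x e α →
                      ⟦ α ⟧ᵍ I ~ ⟦ α [ x := e ]ᵍ ⟧ᵍ I via (Substituted A , Substituted B)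

      substitution (d ≥ d′)   P→A _ =
        ≥-equiv I d (d [ x := e ]ᵗ) d′ (d′ [ x := e ]ᵗ)
          (term-substitution d (P→A ∘ inj₁)) (term-substitution d′ (P→A ∘ inj₂))
      substitution (pred q d) P→A _ = pred-equiv I q d (d [ x := e ]ᵗ) (term-substitution d P→A)
      substitution (¬ᶠ P)     P→A adm = ¬-equiv (substitution P P→A adm)
      substitution (P ∧ Q)    P→A (admP , admQ) =
        ∧-equiv (substitution P (P→A ∘ inj₁) admP) (substitution Q (P→A ∘ inj₂) admQ)
      substitution (∀[ y ] P) P→A adm with y ≟ x
      -- The quantifier overwrites the one variable in which the states may differ, so they become
      -- equal.
      ... | yes refl = equiv
        (λ ν ω νρω D r → subst (⟦ P ⟧ I) (update-cong y r (proj₁ νρω)) (D r))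
        (λ ν ω νρω D r → subst (⟦ P ⟧ I) (sym (update-cong y r (proj₁ νρω))) (D r))
      substitution (∀[ y ] P) P→A (inj₁ y≡x) | no y≢x = ⊥-elim (y≢x y≡x)
      substitution (∀[ y ] P) P→A (inj₂ (adm , y∉e)) | no y≢x =
        ∀-equiv y (substituted-update y (λ x∈P → P→A ((λ x≡y → y≢x (sym x≡y)) , x∈P)) (avoids y≢x y∉e))
          (substitution {Free x P} P id adm)
      substitution (∃[ y ] P) P→A adm with y ≟ x
      ... | yes refl = equiv
        (λ ν ω νρω → map₂ λ {r} → subst (⟦ P ⟧ I) (update-cong y r (proj₁ νρω)))
        (λ ν ω νρω → map₂ λ {r} → subst (⟦ P ⟧ I) (sym (update-cong y r (proj₁ νρω))))
      substitution (∃[ y ] P) P→A (inj₁ y≡x) | no y≢x = ⊥-elim (y≢x y≡x)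
      substitution (∃[ y ] P) P→A (inj₂ (adm , y∉e)) | no y≢x =
        ∃-equiv y (substituted-update y (λ x∈P → P→A ((λ x≡y → y≢x (sym x≡y)) , x∈P)) (avoids y≢x y∉e))
          (substitution {Free x P} P id adm)
      substitution (◇ C ∶ π)  P→A adm = ◇-equiv C (substitution π P→A adm)
      substitution (□ C ∶ π)  P→A adm = □-equiv C (substitution π P→A adm)
      substitution (P ^𝒞)     P→A adm = ^𝒞-equiv (substitution P P→A adm)
      substitution {A} (⟪ α ⟫ π)  P→A (admα , admπ , π→α∌) = ⟪⟫-equiv
        (substitutionᵍ {A} {Free x π} α (P→A ∘ inj₁) (P→A ∘ inj₂) π→α∌ admα)
        (substitution π id admπ)
      substitution (Ξ P₁ P₂ P₃) P→A (adm₁ , adm₂ , adm₃) = Ξ-equiv (substitution P₁ (P→A ∘ inj₁) adm₁)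
        (substitution P₂ (P→A ∘ inj₂ ∘ inj₁) adm₂) (substitution P₃ (P→A ∘ inj₂ ∘ inj₂) adm₃)

      substitutionᵍ (y ≔ d) α→A B→A B→α∌ _ = assign-sim y d (d [ x := e ]ᵗ) (term-substitution d α→A)
        (substituted-update y B→A λ b z z∈ → B→α∌ b z z∈)
      substitutionᵍ (ode i y f Q) α→A B→A B→α∌ (y≢x , adm , y∉e) =
        ode-sim (Substituted (x ∈ᵗ f ⊎ Free x Q)) i y f (f [ x := e ]ᵗ) (λ ν ω (ν≡ω , _) → ν≡ω y y≢x)
          (substituted-update y (α→A ∘ inj₂) (avoids y≢x y∉e))
          (substituted-update y B→A B→α∌)
          (term-substitution f inj₁) (substitution Q inj₂ adm)
      substitutionᵍ (test i Q) α→A B→A B→α∌ adm = test-sim i (substitution Q α→A adm) (substituted-⊆ B→A)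
      substitutionᵍ (α ∪[ i ] β) α→A B→A B→∌ (admα , admβ) = choice-sim i
        (substitutionᵍ α (α→A ∘ inj₁) B→A (λ b z z∈ → B→∌ b z z∈ ∘ inj₁) admα)
        (substitutionᵍ β (α→A ∘ inj₂) B→A (λ b z z∈ → B→∌ b z z∈ ∘ inj₂) admβ)
      substitutionᵍ {A} (α ⨾ β) α→A B→A B→∌ (admα , admβ , β→α∌) = compose-sim
        -- Between the games the value stays known if it was known before and `α` binds nothing
        -- affected. A read of `x` in `β` implies this condition, and so does `B`.
        (substitutionᵍ {B = A × BindsNone α (Affected x e)} α (α→A ∘ inj₁) proj₁ proj₂ admα)
        (substitutionᵍ β (λ x∈β → α→A (inj₂ x∈β) , β→α∌ x∈β)
          (λ b → B→A b , λ z z∈ → B→∌ b z z∈ ∘ inj₁) (λ b z z∈ → B→∌ b z z∈ ∘ inj₂) admβ)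
      substitutionᵍ {A} (α *[ i ]) α→A B→A B→α∌ (adm , α→α∌) =
        -- The invariant claims the value of `x` only if the body binds nothing affected, so every
        -- round preserves it. A read in the next round implies the condition, and so does `B`.
        star-sim {σ = Substituted (A × BindsNone α (Affected x e))} i
          (substitutionᵍ α (λ x∈α → α→A x∈α , α→α∌ x∈α) id proj₂ adm)
          (substituted-⊆ proj₁) (substituted-⊆ λ b → B→A b , B→α∌ b)

    substitution-lemma : ∀ I {k} (P : Formula k) → Admissible x e P → (p q : Point k) →
      Pointwise (Substituted ⊤) p q → (⟦ P ⟧ I p → ⟦ P [ x := e ] ⟧ I q) × (⟦ P [ x := e ] ⟧ I q → ⟦ P ⟧ I p)
    substitution-lemma I P adm p q pρq = to s p q pρq , from s p q pρq
      where s = substitution I P (λ _ → tt) adm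

    substituted-assigned : ∀ ω → Substituted ⊤ (ω [ x ↦ ⟦ e ⟧ᵗ ω ]) ω
    substituted-assigned ω = (λ z → update-other ω _) , λ _ → update-same ω x _

  -- Uniform substitution

  module _ (q : Sym) (u : Var) (Q : Formula state) (I : Interpretation) (ω₀ : State) where

    -- A predicate symbol depends on its argument alone, so the parameters of `Q` are read in the
    -- fixed state `ω₀`.
    instantiated : Interpretation
    instantiated p r with p ≟ˢ q
    ... | yes _ = ⟦ Q ⟧ I (ω₀ [ u ↦ r ])
    ... | no  _ = I p r

    -- Both sides are in the same state; `U` collects variables that still have their initial
    -- values.
    Unchanged : Pred Var 0ℓ → Rel State 0ℓ
    Unchanged U ν ω = ν ≡ ω × Agree U ω ω₀

    _∖_ : Pred Var 0ℓ → Pred Var 0ℓ → Pred Var 0ℓ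
    (U ∖ V) z = U z × ¬ V z

    unchanged-update : ∀ {U V} x → (∀ z → V z → U z) → (∀ z → V z → z ≢ x) → ∀ ν ω r →
      Unchanged U ν ω → Unchanged V (ν [ x ↦ r ]) (ω [ x ↦ r ])
    unchanged-update x V⊆U x∉V ν ω r (refl , agree) =
      refl , λ z Vz → trans (update-other ω r (x∉V z Vz)) (agree z (V⊆U z Vz))

    unchanged-⊆ : ∀ {U V : Pred Var 0ℓ} → (∀ z → V z → U z) → ∀ ν ω → Unchanged U ν ω → Unchanged V ν ω
    unchanged-⊆ V⊆U ν ω (refl , agree) = refl , λ z Vz → agree z (V⊆U z Vz)

    term-unchanged : ∀ {U} e → ∀ ν ω → Unchanged U ν ω → ⟦ e ⟧ᵗ ν ≡ ⟦ e ⟧ᵗ ω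
    term-unchanged e ν ω (refl , _) = refl

    Par : Pred Var 0ℓ
    Par = Parameter q u Q

    uniform-substitution : ∀ {U k} (P : Formula k) → (Occurs q P → ∀ z → Par z → U z) → UAdmissible q u Q P →
      ⟦ P ⟧ instantiated ≈ ⟦ usubst q u Q P ⟧ I via Unchanged U
    uniform-substitutionᵍ : ∀ {U V} α → (Occursᵍ q α → ∀ z → Par z → U z) → (∀ z → V z → U z) → BindsNone α V →
      UAdmissibleᵍ q u Q α →
      ⟦ α ⟧ᵍ instantiated ~ ⟦ usubstᵍ q u Q α ⟧ᵍ I via (Unchanged U , Unchanged V)

    uniform-substitution {U} (d ≥ e) P⊆U _ = equiv (λ { ν ω (refl , _) → id }) (λ { ν ω (refl , _) → id })
    uniform-substitution {U} (pred p e) P⊆U adm with p ≟ˢ q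
    ... | no _ = equiv (λ { ν ω (refl , _) → id }) (λ { ν ω (refl , _) → id })
    -- Coincidence on the parameters moves `Q` from `ω₀` to `ω`, with `u` set to the argument in
    -- both; the substitution lemma then turns this into `Q [ u := e ]` at `ω`.
    ... | yes refl = equiv
      (λ { ν ω (refl , agree) → proj₁ (inst-lemma ω) ∘ to params _ _ (agree-params ω agree) })
      (λ { ν ω (refl , agree) → from params _ _ (agree-params ω agree) ∘ proj₂ (inst-lemma ω) })
      where
      inst-lemma : ∀ ω → _
      inst-lemma ω = substitution-lemma u e I Q (adm refl) _ _ (substituted-assigned u e ω)
      params = coincidence I {V = λ z → Free z Q} Q (λ _ → id)
      agree-params : ∀ ω → Agree U ω ω₀ → Agree (λ z → Free z Q) (ω₀ [ u ↦ ⟦ e ⟧ᵗ ω ]) (ω [ u ↦ ⟦ e ⟧ᵗ ω ])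
      agree-params ω agree z z∈Q = update-pointwise u z
        λ z≢u → sym (agree z (P⊆U refl z (z≢u , z∈Q)))
    uniform-substitution (¬ᶠ P) P⊆U adm = ¬-equiv (uniform-substitution P P⊆U adm)
    uniform-substitution (P ∧ P′) P⊆U (adm , adm′) =
      ∧-equiv (uniform-substitution P (P⊆U ∘ inj₁) adm) (uniform-substitution P′ (P⊆U ∘ inj₂) adm′)
    uniform-substitution {U} (∀[ y ] P) P⊆U (adm , y∉) =
      ∀-equiv y (unchanged-update y (λ _ → proj₁) (λ _ → proj₂))
        (uniform-substitution {U ∖ (_≡ y)} P (λ o z z∈ → P⊆U o z z∈ , λ { refl → y∉ o z∈ }) adm)
    uniform-substitution {U} (∃[ y ] P) P⊆U (adm , y∉) =
      ∃-equiv y (unchanged-update y (λ _ → proj₁) (λ _ → proj₂))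
        (uniform-substitution {U ∖ (_≡ y)} P (λ o z z∈ → P⊆U o z z∈ , λ { refl → y∉ o z∈ }) adm)
    uniform-substitution (◇ C ∶ π) P⊆U adm = ◇-equiv C (uniform-substitution π P⊆U adm)
    uniform-substitution (□ C ∶ π) P⊆U adm = □-equiv C (uniform-substitution π P⊆U adm)
    uniform-substitution (P ^𝒞) P⊆U adm = ^𝒞-equiv (uniform-substitution P P⊆U adm)
    uniform-substitution {U} (⟪ α ⟫ π) P⊆U (admα , admπ , π→α∌) = ⟪⟫-equiv
      (uniform-substitutionᵍ {U} {U ∖ Binds α} α (P⊆U ∘ inj₁) (λ _ → proj₁) (λ _ → proj₂) admα)
      (uniform-substitution π (λ o z z∈ → P⊆U (inj₂ o) z z∈ , π→α∌ o z z∈) admπ)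
    uniform-substitution (Ξ P₁ P₂ P₃) P⊆U (adm₁ , adm₂ , adm₃) = Ξ-equiv
      (uniform-substitution P₁ (P⊆U ∘ inj₁) adm₁) (uniform-substitution P₂ (P⊆U ∘ inj₂ ∘ inj₁) adm₂)
      (uniform-substitution P₃ (P⊆U ∘ inj₂ ∘ inj₂) adm₃)

    uniform-substitutionᵍ (x ≔ e) α⊆U V⊆U α∌ _ =
      assign-sim x e e (term-unchanged e) (unchanged-update x V⊆U α∌)
    uniform-substitutionᵍ {U} (ode i x f P) α⊆U V⊆U α∌ (adm , x∉) =
      ode-sim (Unchanged (U ∖ (_≡ x))) i x f f (λ ν ω (ν≡ω , _) → cong (λ χ → χ x) ν≡ω)
        (unchanged-update x (λ _ → proj₁) (λ _ → proj₂)) (unchanged-update x V⊆U α∌)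
        (term-unchanged f)
        (uniform-substitution P (λ o z z∈ → α⊆U o z z∈ , λ { refl → x∉ o z∈ }) adm)
    uniform-substitutionᵍ (test i P) α⊆U V⊆U α∌ adm =
      test-sim i (uniform-substitution P α⊆U adm) (unchanged-⊆ V⊆U)
    uniform-substitutionᵍ (α ∪[ i ] β) α⊆U V⊆U ∌ (admα , admβ) = choice-sim i
      (uniform-substitutionᵍ α (α⊆U ∘ inj₁) V⊆U (λ z z∈ → ∌ z z∈ ∘ inj₁) admα)
      (uniform-substitutionᵍ β (α⊆U ∘ inj₂) V⊆U (λ z z∈ → ∌ z z∈ ∘ inj₂) admβ)
    uniform-substitutionᵍ {U} (α ⨾ β) α⊆U V⊆U ∌ (admα , admβ , β→α∌) = compose-sim
      (uniform-substitutionᵍ {V = U ∖ Binds α} α (α⊆U ∘ inj₁) (λ _ → proj₁) (λ _ → proj₂) admα)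
      (uniform-substitutionᵍ β (λ o z z∈ → α⊆U (inj₂ o) z z∈ , β→α∌ o z z∈)
        (λ z z∈ → V⊆U z z∈ , ∌ z z∈ ∘ inj₁) (λ z z∈ → ∌ z z∈ ∘ inj₂) admβ)
    uniform-substitutionᵍ {U} (α *[ i ]) α⊆U V⊆U α∌ (adm , α→α∌) =
      -- Variables that the body does not bind keep their initial values in every round; if `q`
      -- occurs in the body, admissibility puts all parameters among them.
      star-sim {σ = Unchanged (U ∖ Binds α)} i
        (uniform-substitutionᵍ α (λ o z z∈ → α⊆U o z z∈ , α→α∌ o z z∈) (λ _ → id) (λ _ → proj₂) adm)
        (unchanged-⊆ λ _ → proj₁) (unchanged-⊆ λ z z∈ → V⊆U z z∈ , α∌ z z∈)

  -- Fixpoints at one coalition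

  Local : (Region → Region) → Set₁
  Local Φ = ∀ c X Y → (∀ ω → X (ω , c) → Y (ω , c)) → ∀ ω → Φ X (ω , c) → Φ Y (ω , c)

  -- Simulation along equality of states, obtained from coincidence on all variables. It contains
  -- monotonicity and the independence from the goal at other coalitions.
  game-local : ∀ I α → Local (⟦ α ⟧ᵍ I)
  game-local I α c X Y X→Y ω = to (coincidenceᵍ I {V = λ _ → ⊤} α _) c X Y
    (λ ν ω ν≡ω → X→Y ω ∘ subst (λ χ → X (χ , c)) (ext λ z → ν≡ω z tt)) ω ω (λ _ _ → refl)

  module _ {Φ : Region → Region} (Φ-local : Local Φ) {i : Player} {c : Coalition} {X : Region} where

    private
      X* : Region
      X* = starᵍ Φ i X

    lfp-fold : i ∈ᶜ c → ∀ ω → X (ω , c) ⊎ Φ X* (ω , c) → X* (ω , c)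
    lfp-fold i∈c ω X⊎ΦX* = inj₁ (i∈c , λ Z Z⊆ pre → pre ω c i∈c (Sum.map₂
      (Φ-local c X* ⌊ Z ⌋ᵇ (λ
        { ν (inj₁ (_ , least))         → least Z Z⊆ pre
        ; ν (inj₂ (W , W⊆ , _ , Wν)) → ⊥-elim (W⊆ ν c Wν i∈c) }) ω) X⊎ΦX*))

    -- The premise concerns `c` only; adding everything at the other coalitions of player `i` turns
    -- `Y` into a prefixpoint that the clause accepts.
    lfp-induction : i ∈ᶜ c → (Y : Region) → (∀ ω → X (ω , c) ⊎ Φ Y (ω , c) → Y (ω , c)) →
                    ∀ ω → X* (ω , c) → Y (ω , c)
    lfp-induction i∈c Y pre ω (inj₂ (Z , Z⊆ , _ , Zω)) = ⊥-elim (Z⊆ ω c Zω i∈c)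
    lfp-induction i∈c Y pre ω (inj₁ (_ , least)) =
      proj₂ (decide⁻ W (least (decide W) (λ ν d → proj₁ ∘ decide⁻ W)
        λ ν d i∈d X⊎ΦW → decide⁺ W (i∈d , λ { refl → pre ν (Sum.map₂
          (Φ-local c _ Y (λ ν Wν → proj₂ (decide⁻ W Wν) refl) ν) X⊎ΦW) }))) refl
      where
      W : Region
      W (ν , d) = i ∈ᶜ d × (d ≡ c → Y (ν , c))

    -- Lambek's argument: by folding and monotonicity, one unfolding of `X*` is itself a
    -- prefixpoint.
    lfp-unfold : i ∈ᶜ c → ∀ ω → X* (ω , c) → X (ω , c) ⊎ Φ X* (ω , c)
    lfp-unfold i∈c = lfp-induction i∈c (λ p → X p ⊎ Φ X* p)
      λ ω → Sum.map₂ (Φ-local c _ X* (lfp-fold i∈c) ω)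

    gfp-unfold : i ∉ᶜ c → ∀ ω → X* (ω , c) → X (ω , c) × Φ X* (ω , c)
    gfp-unfold i∉c ω (inj₁ (i∈c , _)) = ⊥-elim (i∉c i∈c)
    gfp-unfold i∉c ω (inj₂ (Z , Z⊆ , post , Zω)) = map₂
      (Φ-local c ⌊ Z ⌋ᵇ X* (λ ν Zν → inj₂ (Z , Z⊆ , post , Zν)) ω) (post ω c Zω)

    -- `Y` is cut down to `c`; locality ensures that the cut does not affect `Φ` there.
    gfp-coinduction : i ∉ᶜ c → (Y : Region) → (∀ ω → Y (ω , c) → X (ω , c) × Φ Y (ω , c)) →
                      ∀ ω → Y (ω , c) → X* (ω , c)
    gfp-coinduction i∉c Y post ω Yω = inj₂ (decide W ,
      (λ ν d Wν → subst (i ∉ᶜ_) (sym (proj₁ (decide⁻ W Wν))) i∉c) , W-post , decide⁺ W (refl , Yω))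
      where
      W : Region
      W (ν , d) = d ≡ c × Y (ν , c)
      W-post : ∀ ν d → ⌊ decide W ⌋ᵇ (ν , d) → X (ν , d) × Φ ⌊ decide W ⌋ᵇ (ν , d)
      W-post ν d Wν with decide⁻ W Wν
      ... | refl , Yν = map₂ (Φ-local c Y _ (λ ν Yν → decide⁺ W (refl , Yν)) ν) (post ν Yν)

    gfp-fold : i ∉ᶜ c → ∀ ω → X (ω , c) × Φ X* (ω , c) → X* (ω , c)
    gfp-fold i∉c = gfp-coinduction i∉c (λ p → X p × Φ X* p)
      λ ω → map₂ (Φ-local c X* _ (gfp-unfold i∉c) ω)

  -- Solvable differential equations

  term-bounded : ∀ ω x f → F.LocallyBounded (λ a → ⟦ f ⟧ᵗ (ω [ x ↦ a ]))
  term-bounded ω x (var z) with z ≟ x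
  ... | yes _ = F.bounded-id
  ... | no  _ = F.bounded-const (ω z)
  term-bounded ω x (const q) = F.bounded-const (F.fromℚ q)
  term-bounded ω x (d ⊕ e)   = F.bounded-+ (term-bounded ω x d) (term-bounded ω x e)
  term-bounded ω x (d ⊗ e)   = F.bounded-* (term-bounded ω x d) (term-bounded ω x e)

  term-lipschitz : ∀ ω x f → F.LocallyLipschitz (λ a → ⟦ f ⟧ᵗ (ω [ x ↦ a ]))
  term-lipschitz ω x (var z) with z ≟ x
  ... | yes _ = F.lipschitz-id
  ... | no  _ = F.lipschitz-const (ω z)
  term-lipschitz ω x (const q) = F.lipschitz-const (F.fromℚ q)
  term-lipschitz ω x (d ⊕ e)   = F.lipschitz-+ (term-lipschitz ω x d) (term-lipschitz ω x e)
  term-lipschitz ω x (d ⊗ e)   = F.lipschitz-* (term-bounded ω x d) (term-bounded ω x e)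
    (term-lipschitz ω x d) (term-lipschitz ω x e)

  -- All variables except `x` are constant along the flow, so `f` becomes a polynomial in `x` with
  -- coefficients from `ω`. The flow and `y` solve the same scalar equation with the same initial
  -- value.
  solution-unique : ∀ {x D r φ} f t y ω → Solution x f t y →
    F.0# F.≤ r → Flow x f D r φ → φ F.0# ≡ ω → φ r ≡ ω [ x ↦ ⟦ y ⟧ᵗ (ω [ t ↦ r ]) ]
  solution-unique {x} {D} {r} {φ} f t y ω sol 0≤r flow φ0≡ω =
    trans (φ≡ r (0≤r , F.≤-refl)) (cong (ω [ x ↦_])
      (F.uniqueness (term-lipschitz ω x f) u′ v′ u0≡v0 r (0≤r , F.≤-refl)))
    where
    v : R → R
    v s = ⟦ y ⟧ᵗ (ω [ t ↦ s ])
    φ≡ : ∀ s → s F.∈[0, r ] → φ s ≡ ω [ x ↦ φ s x ]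
    φ≡ s s∈ = update-self x (flow-constant {f = f} {D = D} flow φ0≡ω s s∈)
    u′ : ∀ s → s F.∈[0, r ] → F.HasDerivativeOn[0, r ] (λ s → φ s x) s (⟦ f ⟧ᵗ (ω [ x ↦ φ s x ]))
    u′ s s∈ = subst (F.HasDerivativeOn[0, r ] (λ s → φ s x) s) (cong ⟦ f ⟧ᵗ (φ≡ s s∈)) (proj₁ (proj₂ (flow s s∈)))
    v′ : ∀ s → s F.∈[0, r ] → F.HasDerivativeOn[0, r ] v s (⟦ f ⟧ᵗ (ω [ x ↦ v s ]))
    v′ s s∈ = subst (λ u → F.HasDerivativeOn[0, r ] u s (⟦ f ⟧ᵗ (ω [ x ↦ v s ])))
      (ext λ s → update-same ω x (v s)) (proj₁ (proj₂ (proj₂ (sol ω) r 0≤r s s∈)))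
    u0≡v0 : φ F.0# x ≡ v F.0#
    u0≡v0 = trans (cong (λ χ → χ x) φ0≡ω) (sym (proj₁ (sol ω)))

  fromℚ-0 : F.fromℚ 0ℚ ≡ F.0#
  fromℚ-0 = F.zeroˡ _

  module _ {x : Var} {f : Term} {t : Var} (y : Term) (π : Formula game) (I : Interpretation)
    (sol : Solution x f t y) (fresh : FreshTime t x f π)
    where

    -- The assignment is played with `t` set to `r`; after it, the two states differ at most in `t`,
    -- which `π` does not read.
    after : ∀ {ω c} r → ⟦ ⟪ x ≔ y ⟫ π ⟧ I (ω [ t ↦ r ] , c) → ⟦ π ⟧ I (ω [ x ↦ ⟦ y ⟧ᵗ (ω [ t ↦ r ]) ] , c)
    after {ω} {c} r = to (coincidence I {V = _≢ t} π λ { z z∈π refl → proj₂ (proj₂ fresh) z∈π }) _ _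
      ((λ z z≢t → update-pointwise x z λ _ → update-other ω r z≢t) , refl)

    before : ∀ {ω c} r → ⟦ π ⟧ I (ω [ x ↦ ⟦ y ⟧ᵗ (ω [ t ↦ r ]) ] , c) → ⟦ ⟪ x ≔ y ⟫ π ⟧ I (ω [ t ↦ r ] , c)
    before {ω} {c} r = from (coincidence I {V = _≢ t} π λ { z z∈π refl → proj₂ (proj₂ fresh) z∈π }) _ _
      ((λ z z≢t → update-pointwise x z λ _ → update-other ω r z≢t) , refl)

    solution-flow : ∀ ω r → F.0# F.≤ r →
      Flow x f (⟦ ⊤ᶠ ⟧ I) r (λ s → ω [ x ↦ ⟦ y ⟧ᵗ (ω [ t ↦ s ]) ])
    solution-flow ω r 0≤r s s∈ = F.≤-refl , proj₂ (proj₂ (sol ω) r 0≤r s s∈)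

    solution-start : ∀ ω → ω [ x ↦ ⟦ y ⟧ᵗ (ω [ t ↦ F.0# ]) ] ≡ ω
    solution-start ω = trans (cong (ω [ x ↦_]) (proj₁ (sol ω))) (sym (update-self x λ _ _ → refl))

    nonNeg⁺ : ∀ {ω r} → F.0# F.≤ r → ⟦ var t ≥ const 0ℚ ⟧ I (ω [ t ↦ r ])
    nonNeg⁺ {ω} {r} = subst id (cong₂ F._≤_ (sym fromℚ-0) (sym (update-same ω t r)))

    nonNeg⁻ : ∀ {ω r} → ⟦ var t ≥ const 0ℚ ⟧ I (ω [ t ↦ r ]) → F.0# F.≤ r
    nonNeg⁻ {ω} {r} = subst id (cong₂ F._≤_ fromℚ-0 (update-same ω t r))

    solve-∈ : ∀ {i ω c} → i ∈ᶜ c → ⟦ ⟪ ode i x f ⊤ᶠ ⟫ π ⟧ I (ω , c) →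
      Σ[ r ∈ R ] (⟦ var t ≥ const 0ℚ ⟧ I (ω [ t ↦ r ]) × ⟦ ⟪ x ≔ y ⟫ π ⟧ I (ω [ t ↦ r ] , c))
    solve-∈ i∈c (inj₂ (i∉c , _)) = ⊥-elim (i∉c i∈c)
    solve-∈ {ω = ω} {c} i∈c (inj₁ (_ , r , φ , 0≤r , flow , φ0≡ω , πφ)) = r , nonNeg⁺ 0≤r ,
      before r (subst (λ χ → ⟦ π ⟧ I (χ , c)) (solution-unique {D = ⟦ ⊤ᶠ ⟧ I} f t y ω sol 0≤r flow φ0≡ω) πφ)

    solve-∈⁻ : ∀ {i ω c} → i ∈ᶜ c → ∀ r → ⟦ var t ≥ const 0ℚ ⟧ I (ω [ t ↦ r ]) →
      ⟦ ⟪ x ≔ y ⟫ π ⟧ I (ω [ t ↦ r ] , c) → ⟦ ⟪ ode i x f ⊤ᶠ ⟫ π ⟧ I (ω , c)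
    solve-∈⁻ {ω = ω} i∈c r 0≤r πω =
      inj₁ (i∈c , r , _ , nonNeg⁻ 0≤r , solution-flow ω r (nonNeg⁻ 0≤r) , solution-start ω , after r πω)

    solve-∉ : ∀ {i ω c} → i ∉ᶜ c → ⟦ ⟪ ode i x f ⊤ᶠ ⟫ π ⟧ I (ω , c) →
      ∀ r → ⟦ var t ≥ const 0ℚ ⟧ I (ω [ t ↦ r ]) → ⟦ ⟪ x ≔ y ⟫ π ⟧ I (ω [ t ↦ r ] , c)
    solve-∉ i∉c (inj₁ (i∈c , _)) = ⊥-elim (i∉c i∈c)
    solve-∉ {ω = ω} i∉c (inj₂ (_ , all)) r 0≤r =
      before r (all r _ (nonNeg⁻ 0≤r) (solution-flow ω r (nonNeg⁻ 0≤r)) (solution-start ω))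

    solve-∉⁻ : ∀ {i ω c} → i ∉ᶜ c →
      (∀ r → ⟦ var t ≥ const 0ℚ ⟧ I (ω [ t ↦ r ]) → ⟦ ⟪ x ≔ y ⟫ π ⟧ I (ω [ t ↦ r ] , c)) →
      ⟦ ⟪ ode i x f ⊤ᶠ ⟫ π ⟧ I (ω , c)
    solve-∉⁻ {ω = ω} {c} i∉c all = inj₂ (i∉c , λ r φ 0≤r flow φ0≡ω →
      subst (λ χ → ⟦ π ⟧ I (χ , c)) (sym (solution-unique {D = ⟦ ⊤ᶠ ⟧ I} f t y ω sol 0≤r flow φ0≡ω))
        (after r (all r (nonNeg⁺ 0≤r))))

  -- Classical connectives, singletons and tautologies

  decided : ∀ {A : Set} (A? : Dec A) → (T (does A?) → A) × (A → T (does A?))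
  decided (yes a) = (λ _ → a) , λ _ → tt
  decided (no ¬a) = (λ ()) , λ a → ¬a a

  by-contradiction : ∀ {A : Set} → ¬ ¬ A → A
  by-contradiction {A} ¬¬A with em {A}
  ... | yes a = a
  ... | no ¬a = ⊥-elim (¬¬A ¬a)

  ⇒⁺ : ∀ {A B : Set} → (A → B) → ¬ (A × ¬ B)
  ⇒⁺ f (a , ¬b) = ¬b (f a)

  ⇒⁻ : ∀ {A B : Set} → ¬ (A × ¬ B) → A → B
  ⇒⁻ h a = by-contradiction λ ¬b → h (a , ¬b)

  ⇔⁺ : ∀ {A B : Set} → (A → B) → (B → A) → ¬ (A × ¬ B) × ¬ (B × ¬ A)
  ⇔⁺ f g = ⇒⁺ f , ⇒⁺ g

  ∨⁺ : ∀ {A B : Set} → A ⊎ B → ¬ (¬ A × ¬ B)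
  ∨⁺ a⊎b (¬a , ¬b) = [ ¬a , ¬b ]′ a⊎b

  ∨⁻ : ∀ {A B : Set} → ¬ (¬ A × ¬ B) → A ⊎ B
  ∨⁻ h = by-contradiction λ ¬a⊎b → h (¬a⊎b ∘ inj₁ , ¬a⊎b ∘ inj₂)

  singleton⁺ : ∀ c → T (｛ c ｝ c)
  singleton⁺ c with Vec.≡-dec Bool._≟_ (members c) (members c)
  ... | yes _   = tt
  ... | no  c≢c = ⊥-elim (c≢c refl)

  -- Equality of the member sets suffices because the nonemptiness proofs are irrelevant.
  singleton⁻ : ∀ c d → T (｛ c ｝ d) → d ≡ c
  singleton⁻ (coalition m _) (coalition n _) d∈ with Vec.≡-dec Bool._≟_ n m
  ... | yes refl = refl

  ◇⁺ : ∀ c (π : Formula game) I ω → ⟦ π ⟧ I (ω , c) → ⟦ ◇ ｛ c ｝ ∶ π ⟧ I ω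
  ◇⁺ c π I ω πω = c , singleton⁺ c , πω

  ◇⁻ : ∀ c (π : Formula game) I ω → ⟦ ◇ ｛ c ｝ ∶ π ⟧ I ω → ⟦ π ⟧ I (ω , c)
  ◇⁻ c π I ω (d , d∈ , πω) with singleton⁻ c d d∈
  ... | refl = πω

  ◇-⇔ : ∀ c (π ψ : Formula game) I ω → (⟦ π ⟧ I (ω , c) → ⟦ ψ ⟧ I (ω , c)) →
        (⟦ ψ ⟧ I (ω , c) → ⟦ π ⟧ I (ω , c)) → ⟦ ◇ ｛ c ｝ ∶ π ⇔ ◇ ｛ c ｝ ∶ ψ ⟧ I ω
  ◇-⇔ c π ψ I ω f g = ⇔⁺ (◇⁺ c ψ I ω ∘ f ∘ ◇⁻ c π I ω) (◇⁺ c π I ω ∘ g ∘ ◇⁻ c ψ I ω)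

  evaluate-sound : ∀ I ω (P : Formula state) → let b = evaluate (λ P → does (em {⟦ P ⟧ I ω})) P in
                   (T b → ⟦ P ⟧ I ω) × (⟦ P ⟧ I ω → T b)
  evaluate-sound I ω (¬ᶠ P) with evaluate (λ P → does (em {⟦ P ⟧ I ω})) P | evaluate-sound I ω P
  ... | true  | P⁺ , _  = (λ ()) , λ ¬P → ¬P (P⁺ tt)
  ... | false | _  , P⁻ = (λ _ → P⁻) , λ _ → tt
  evaluate-sound I ω (P ∧ Q) =
    let P⁺ , P⁻ = evaluate-sound I ω P
        Q⁺ , Q⁻ = evaluate-sound I ω Q
    in map P⁺ Q⁺ ∘ Equivalence.to Bool.T-∧ , Equivalence.from Bool.T-∧ ∘ map P⁻ Q⁻
  -- Naming each remaining constructor lets `evaluate` reduce to the valuation.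
  evaluate-sound I ω P@(_ ≥ _)    = decided (em {⟦ P ⟧ I ω})
  evaluate-sound I ω P@(pred _ _) = decided (em {⟦ P ⟧ I ω})
  evaluate-sound I ω P@(∀[ _ ] _) = decided (em {⟦ P ⟧ I ω})
  evaluate-sound I ω P@(∃[ _ ] _) = decided (em {⟦ P ⟧ I ω})
  evaluate-sound I ω P@(◇ _ ∶ _)  = decided (em {⟦ P ⟧ I ω})
  evaluate-sound I ω P@(□ _ ∶ _)  = decided (em {⟦ P ⟧ I ω})

  -- Finite disjunctions and conjunctions over coalitions

  ⋁-sound : ∀ {I ω} Ps → (⟦ ⋁ Ps ⟧ I ω → Any (λ P → ⟦ P ⟧ I ω) Ps) × (Any (λ P → ⟦ P ⟧ I ω) Ps → ⟦ ⋁ Ps ⟧ I ω)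
  ⋁-sound []       = (λ ⊥ → ⊥-elim (⊥ F.≤-refl)) , λ ()
  ⋁-sound (P ∷ Ps) =
    [ here , there ∘ proj₁ (⋁-sound Ps) ]′ ∘ ∨⁻ ,
    λ { (here P) → ∨⁺ (inj₁ P) ; (there Ps′) → ∨⁺ (inj₂ (proj₂ (⋁-sound Ps) Ps′)) }

  ⋀-sound : ∀ {I ω} Ps → (⟦ ⋀ Ps ⟧ I ω → All (λ P → ⟦ P ⟧ I ω) Ps) × (All (λ P → ⟦ P ⟧ I ω) Ps → ⟦ ⋀ Ps ⟧ I ω)
  ⋀-sound []       = (λ _ → []) , λ _ → F.≤-refl
  ⋀-sound (P ∷ Ps) =
    (λ { (P , Ps′) → P ∷ proj₁ (⋀-sound Ps) Ps′ }) ,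
    λ { (P ∷ Ps′) → P , proj₂ (⋀-sound Ps) Ps′ }

  ∈-allCoalitions : ∀ c → c ∈ˡ allCoalitions
  ∈-allCoalitions (coalition (inside  ∷ᵛ outside ∷ᵛ outside ∷ᵛ []ᵛ) _) = here refl
  ∈-allCoalitions (coalition (outside ∷ᵛ inside  ∷ᵛ outside ∷ᵛ []ᵛ) _) = there (here refl)
  ∈-allCoalitions (coalition (outside ∷ᵛ outside ∷ᵛ inside  ∷ᵛ []ᵛ) _) = there (there (here refl))
  ∈-allCoalitions (coalition (inside  ∷ᵛ inside  ∷ᵛ outside ∷ᵛ []ᵛ) _) = there (there (there (here refl)))
  ∈-allCoalitions (coalition (inside  ∷ᵛ outside ∷ᵛ inside  ∷ᵛ []ᵛ) _) = there (there (there (there (here refl))))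
  ∈-allCoalitions (coalition (outside ∷ᵛ inside  ∷ᵛ inside  ∷ᵛ []ᵛ) _) = there (there (there (there (there (here refl)))))
  ∈-allCoalitions (coalition (inside  ∷ᵛ inside  ∷ᵛ inside  ∷ᵛ []ᵛ) _) =
    there (there (there (there (there (there (here refl))))))
  -- The irrelevant nonemptiness proof may be consumed here, since it only serves to reach a
  -- contradiction.
  ∈-allCoalitions (coalition (outside ∷ᵛ outside ∷ᵛ outside ∷ᵛ []ᵛ) nonempty) = ⊥-elim-irr (empty nonempty)
    where
    empty : ¬ Nonempty (outside ∷ᵛ outside ∷ᵛ outside ∷ᵛ []ᵛ)
    empty (0F , ())
    empty (1F , Vec.there ())
    empty (2F , Vec.there (Vec.there ()))

  module _ {I : Interpretation} {ω : State} (P₁ P₂ P₃ : Formula state) where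

    component-sound : ∀ i → ⟦ component P₁ P₂ P₃ i ⟧ I ω ≡
      Vec.lookup (⟦ P₁ ⟧ I ∷ᵛ ⟦ P₂ ⟧ I ∷ᵛ ⟦ P₃ ⟧ I ∷ᵛ []ᵛ) i ω
    component-sound 0F = refl
    component-sound 1F = refl
    component-sound 2F = refl

    Ξ-sound : ∀ c → let Ps = List.map (component P₁ P₂ P₃) (filter (_∈? members c) (allFin 3)) in
      (⟦ Ξ P₁ P₂ P₃ ⟧ I (ω , c) → ⟦ ⋀ Ps ⟧ I ω) × (⟦ ⋀ Ps ⟧ I ω → ⟦ Ξ P₁ P₂ P₃ ⟧ I (ω , c))
    Ξ-sound c =
      (λ Ξω → proj₂ (⋀-sound _) (All.map⁺ (All.tabulate λ {i} i∈ →
        subst id (sym (component-sound i)) (Ξω i (proj₂ (∈-filter⁻ (_∈? members c) {xs = allFin 3} i∈)))))) ,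
      λ ⋀ω i i∈c → subst id (component-sound i)
        (All.lookup (All.map⁻ (proj₁ (⋀-sound _) ⋀ω)) (∈-filter⁺ (_∈? members c) (∈-allFin i) i∈c))

  -- Soundness of the axioms and rules

  soundness : ∀ {P} → ⊢ P → Valid P
  soundness (taut {P} valid) I ω = proj₁ (evaluate-sound I ω P) (subst T (sym (valid _)) tt)
  soundness (mp P⇒Q P) I ω = ⇒⁻ (soundness P⇒Q I ω) (soundness P I ω)
  soundness (gen x P) I ω r = soundness P I (ω [ x ↦ r ])
  soundness (inst {P} {x} {e} adm) I ω = ⇒⁺ λ ∀P →
    proj₁ (substitution-lemma x e I P adm _ ω (substituted-assigned x e ω)) (∀P _)
  soundness dist I ω = ⇒⁺ λ ∀P⇒Q → ⇒⁺ λ ∀P r → ⇒⁻ (∀P⇒Q r) (∀P r)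
  soundness (vac {P} {x} x∉P) I ω = ⇒⁺ λ Pω r →
    to (coincidence I {V = λ z → Free z P} P λ _ → id) ω _
      (λ z z∈P → sym (update-other ω r λ { refl → x∉P z∈P })) Pω
  soundness ∃-∀ I ω = ⇔⁺ (λ { (r , Pr) ∀¬P → ∀¬P r Pr })
    λ ¬∀¬P → by-contradiction λ ¬∃P → ¬∀¬P λ r Pr → ¬∃P (r , Pr)
  soundness ≐-refl I ω = F.≤-refl , F.≤-refl
  -- Both instances are compared with `P` in the state where `x` has the common value of `e` and
  -- `e′`.
  soundness (≐-subst {P} {x} {e} {e′} adm adm′) I ω = ⇒⁺ λ { (e≥e′ , e′≥e) → ⇒⁺ λ Pe →
    proj₁ (substitution-lemma x e′ I P adm′ _ ω (substituted-assigned x e′ ω))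
      (subst (λ r → ⟦ P ⟧ I (ω [ x ↦ r ])) (F.antisym e′≥e e≥e′)
        (proj₂ (substitution-lemma x e I P adm _ ω (substituted-assigned x e ω)) Pe)) }
  soundness (assign {c} {x} {e} {π} adm) I ω = ◇-⇔ c (⟪ x ≔ e ⟫ π) (π [ x := e ]) I ω
    (proj₁ (substitution-lemma x e I π adm _ _ (substituted-assigned x e ω , refl)))
    (proj₂ (substitution-lemma x e I π adm _ _ (substituted-assigned x e ω , refl)))
  soundness (test∈ {c} {i} {Q} {π} i∈c) I ω = ◇-⇔ c (⟪ test i Q ⟫ π) (Q ^𝒞 ∧ π) I ω
    (λ { (inj₁ (_ , Q , π)) → Q , π ; (inj₂ (i∉c , _)) → ⊥-elim (i∉c i∈c) })
    (λ { (Q , π) → inj₁ (i∈c , Q , π) })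
  soundness (test∉ {c} {i} {Q} {π} i∉c) I ω = ◇-⇔ c (⟪ test i Q ⟫ π) (¬ᶠ (Q ^𝒞) ∨ π) I ω
    (λ { (inj₁ (i∈c , _)) → ⊥-elim (i∉c i∈c) ; (inj₂ (_ , ¬Q⊎π)) → ∨⁺ ¬Q⊎π })
    (λ h → inj₂ (i∉c , ∨⁻ h))
  soundness (solve∈ {c} {i} {x} {f} {t} {y} {π} i∈c sol fresh) I ω = ⇔⁺
    (λ h → let r , 0≤r , πr = solve-∈ y π I sol fresh i∈c (◇⁻ c (⟪ ode i x f ⊤ᶠ ⟫ π) I ω h)
           in r , 0≤r , ◇⁺ c (⟪ x ≔ y ⟫ π) I (ω [ t ↦ r ]) πr)
    (λ { (r , 0≤r , πr) → ◇⁺ c (⟪ ode i x f ⊤ᶠ ⟫ π) I ω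
        (solve-∈⁻ y π I sol fresh i∈c r 0≤r (◇⁻ c (⟪ x ≔ y ⟫ π) I (ω [ t ↦ r ]) πr)) })
  soundness (solve∉ {c} {i} {x} {f} {t} {y} {π} i∉c sol fresh) I ω = ⇔⁺
    (λ h r → ⇒⁺ λ 0≤r → ◇⁺ c (⟪ x ≔ y ⟫ π) I (ω [ t ↦ r ])
      (solve-∉ y π I sol fresh i∉c (◇⁻ c (⟪ ode i x f ⊤ᶠ ⟫ π) I ω h) r 0≤r))
    (λ h → ◇⁺ c (⟪ ode i x f ⊤ᶠ ⟫ π) I ω (solve-∉⁻ y π I sol fresh i∉c λ r 0≤r →
      ◇⁻ c (⟪ x ≔ y ⟫ π) I (ω [ t ↦ r ]) (⇒⁻ (h r) 0≤r)))
  soundness (choice∈ {c} {i} {α} {β} {π} i∈c) I ω = ◇-⇔ c (⟪ α ∪[ i ] β ⟫ π) (⟪ α ⟫ π ∨ ⟪ β ⟫ π) I ω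
    (∨⁺ ∘ λ { (inj₁ (a , _)) → inj₁ a ; (inj₂ (inj₁ (a , _))) → inj₁ a ; (inj₂ (inj₂ (b , _))) → inj₂ b })
    (λ h → inj₂ (Sum.map (_, i∈c) (_, i∈c) (∨⁻ h)))
  soundness (choice∉ {c} {i} {α} {β} {π} i∉c) I ω = ◇-⇔ c (⟪ α ∪[ i ] β ⟫ π) (⟪ α ⟫ π ∧ ⟪ β ⟫ π) I ω
    (λ { (inj₁ ab) → ab ; (inj₂ (inj₁ (_ , i∈c))) → ⊥-elim (i∉c i∈c) ; (inj₂ (inj₂ (_ , i∈c))) → ⊥-elim (i∉c i∈c) })
    inj₁
  soundness compose I ω = ⇔⁺ id id
  soundness (unfold∈ {c} {i} {α} {π} i∈c) I ω = ◇-⇔ c (⟪ α *[ i ] ⟫ π) (π ∨ ⟪ α ⟫ ⟪ α *[ i ] ⟫ π) I ω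
    (∨⁺ ∘ lfp-unfold (game-local I α) {X = ⟦ π ⟧ I} i∈c ω)
    (lfp-fold (game-local I α) {X = ⟦ π ⟧ I} i∈c ω ∘ ∨⁻)
  soundness (unfold∉ {c} {i} {α} {π} i∉c) I ω = ◇-⇔ c (⟪ α *[ i ] ⟫ π) (π ∧ ⟪ α ⟫ ⟪ α *[ i ] ⟫ π) I ω
    (gfp-unfold (game-local I α) {X = ⟦ π ⟧ I} i∉c ω)
    (gfp-fold (game-local I α) {X = ⟦ π ⟧ I} i∉c ω)
  soundness (fp {c} {i} {α} {π} {ψ} i∈c prem) I ω = ◇⁺ c (⟪ α *[ i ] ⟫ π ⇒ ψ) I ω (⇒⁺
    -- The induction passes through other states, so the premise is used at every `ν`, as its
    -- validity permits.
    (lfp-induction (game-local I α) i∈c (⟦ ψ ⟧ I)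
      (λ ν h → ⇒⁻ (◇⁻ c (π ∨ ⟪ α ⟫ ψ ⇒ ψ) I ν (soundness prem I ν)) (∨⁺ h)) ω))
  soundness (ind {c} {i} {α} {π} i∉c prem) I ω = ◇⁺ c (π ⇒ ⟪ α *[ i ] ⟫ π) I ω (⇒⁺
    (gfp-coinduction (game-local I α) i∉c (⟦ π ⟧ I)
      (λ ν h → h , ⇒⁻ (◇⁻ c (π ⇒ ⟪ α ⟫ π) I ν (soundness prem I ν)) h) ω))
  soundness (mono {c} {α} {π} {ψ} prem) I ω = ◇⁺ c (⟪ α ⟫ π ⇒ ⟪ α ⟫ ψ) I ω (⇒⁺
    (game-local I α c _ _ (λ ν → ⇒⁻ (◇⁻ c (π ⇒ ψ) I ν (soundness prem I ν))) ω))
  soundness ◇-∪ I ω = ⇔⁺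
    (λ { (d , d∈ , πω) → ∨⁺ (Sum.map (λ d∈C → d , d∈C , πω) (λ d∈c → d , d∈c , πω) (Equivalence.to Bool.T-∨ d∈)) })
    ([ (λ { (d , d∈C , πω) → d , Equivalence.from Bool.T-∨ (inj₁ d∈C) , πω })
     , (λ { (d , d∈c , πω) → d , Equivalence.from Bool.T-∨ (inj₂ d∈c) , πω }) ]′ ∘ ∨⁻)
  soundness (◇-Ξ {C} {P₁} {P₂} {P₃}) I ω = ⇔⁺
    (λ { (c , c∈C , Ξω) → proj₂ (⋁-sound _) (Any.map⁺ (lose
      (∈-filter⁺ (T? ∘ C) (∈-allCoalitions c) c∈C) (proj₁ (Ξ-sound P₁ P₂ P₃ c) Ξω))) })
    λ ⋁ω → let c , c∈ , ⋀ω = find (Any.map⁻ (proj₁ (⋁-sound _) ⋁ω))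
           in c , proj₂ (∈-filter⁻ (T? ∘ C) {xs = allCoalitions} c∈) , proj₂ (Ξ-sound P₁ P₂ P₃ c) ⋀ω
  soundness (◇-^𝒞 (c , c∈C)) I ω = ⇔⁺ (λ { (_ , _ , Pω) → Pω }) (λ Pω → c , c∈C , Pω)
  soundness ◇-∨ I ω = ⇔⁺
    (λ { (c , c∈C , h) → ∨⁺ (Sum.map (λ πω → c , c∈C , πω) (λ ψω → c , c∈C , ψω) (∨⁻ h)) })
    ([ (λ { (c , c∈C , πω) → c , c∈C , ∨⁺ (inj₁ πω) }) , (λ { (c , c∈C , ψω) → c , c∈C , ∨⁺ (inj₂ ψω) }) ]′ ∘ ∨⁻)
  soundness ◇-□ I ω = ⇔⁺
    (λ ¬◇¬π c c∈C → by-contradiction λ ¬πω → ¬◇¬π (c , c∈C , ¬πω))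
    (λ { □π (c , c∈C , ¬πω) → ¬πω (□π c c∈C) })
  soundness (◇⇔□ {c} {π}) I ω = ⇔⁺
    (λ ◇π d d∈c → subst (λ d → ⟦ π ⟧ I (ω , d)) (sym (singleton⁻ c d d∈c)) (◇⁻ c π I ω ◇π))
    (λ □π → ◇⁺ c π I ω (□π c (singleton⁺ c)))
  -- The premise holds in all interpretations, in particular in the one built from the current state
  -- `ω`, in which every variable still has its initial value.
  soundness (us {P} q u Q adm prem) I ω =
    to (uniform-substitution q u Q I ω {U = λ _ → ⊤} P (λ _ _ _ → tt) adm) ω ω (refl , λ _ _ → refl)
      (soundness prem (instantiated q u Q I ω) ω)

theorem10 : ExcludedMiddle 0ℓ → Extensionality 0ℓ 0ℓ →
    (ℝ : CompleteOrderedField) →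
    {Var : Set} (_≟_ : DecidableEquality Var) →
    {Sym : Set} (_≟ˢ_ : DecidableEquality Sym) →
    let open Logic ℝ _≟_ _≟ˢ_ in
    ∀ {P} → ⊢ P → Valid P
theorem10 em ext ℝ _≟_ _≟ˢ_ = Soundness.soundness em ext ℝ _≟_ _≟ˢ_
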